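{- For visible online service on every finite metric space, the exact-Steiner phase algorithm and the terminal-MST envelope algorithm (both defined in the context) have competitive ratios $12$ and $20$, respectively, under automatic service; that is, for every finite input $I$ their costs when executed under automatic service are at most $12\operatorname{OPT}_{\mathrm{auto}}(I)$ and $20\operatorname{OPT}_{\mathrm{auto}}(I)$, respectively, where $\operatorname{OPT}_{\mathrm{auto}}(I)$ is the automatic-service offline optimum.
   Context: Model. $(X,d)$ is a finite metric space and $s_0\in X$ is the initial server position. An input $I$ is a finite set of request occurrences; each request $q$ has an arrival time $a(q)\ge 0$ and a location $x(q)\in X$. An arrival epoch is the set of all requests sharing one arrival time. A walk $P=(v_0,\ldots,v_\ell)$ in $X$ ($\ell\ge 0$) is executed instantaneously at one time, visits its listed vertices, and has length $\operatorname{len}(P)=\sum_i d(v_{i-1},v_i)$. A schedule is a finite sequence of atomic actions with nondecreasing timestamps. At time $t$ the complete epoch arriving at $t$ is processed first; then one action at $t$ performs a finite ordered sequence of walks, and no further arrival is processed until the action ends. The first walk starts at $s_0$ and every later one starts where its predecessor ended. A walk $P$ at time $t$ during which a nonempty set $B$ of pending requests is served is one service event of cost $\operatorname{len}(P)+\max_{q\in B}(t-a(q))$; a walk serving no request costs $\operatorname{len}(P)$. The cost of a schedule is the sum of these costs; every request must eventually be served. Automatic service: every pending request whose location is visited by a walk is served in that event, and a request arriving at the current server position is served immediately at zero cost. $\operatorname{OPT}_{\mathrm{auto}}(I)$ is the infimum of the cost over feasible clairvoyant automatic schedules. Visible: the location of a request is revealed at its arrival. Notation. For $A\subseteq X$,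 $\operatorname{ST}_X(A)$ is the minimum of $\sum_{\{u,v\}\in E(F)}d(u,v)$ over trees $F$ in the complete graph on $X$ with $A\subseteq V(F)$; $\operatorname{MST}(A)$ is the minimum weight of a spanning tree of the complete graph on $A$ with weights $d$. Both algorithms. Maintain an anchor $s$ (initially $s_0$), where the server is parked while waiting. Every request arriving at the anchor is served immediately at zero cost and discarded. A phase starts with the first complete epoch containing a request not located at $s$; its set $P$ consists of the requests of that epoch not at $s$, together with all later arrivals not at $s$ until the phase ends. Let $\alpha=\min_{q\in P}a(q)$ and, at time $t$ of the phase, $A(t)=\{s\}\cup\{x(q):q\in P\text{ has arrived by }t\}$. The phase triggers at the first time $t$ (tested after processing the complete epoch at $t$) with $t-\alpha\ge\theta(t)$. At the trigger a tree $F$ is traversed by an open depth-first walk from $s$ to the location $x(p)$ of some chosen $p\in P$, using each edge of the tree path from $s$ to $x(p)$ once and every other edge twice; this is one service event serving all of $P$. Then $s\leftarrow x(p)$ and the phase ends. Ties are broken canonically. - Exact-Steiner phase algorithm: $\theta(t)=\operatorname{ST}_X(A(t))$, $F$ is a tree attaining $\operatorname{ST}_X(A(t))$ (from an oracle), and $p$ has location farthest from $s$ in $F$. - Terminal-MST envelope algorithm: $\theta(t)=\frac12\max_{u\le t}\operatorname{MST}(A(u))$, the maximum being over times $u$ of the current phase, $F$ is a minimum spanning tree on $A(t)$, and $p\in P$ is chosen canonically. -}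

module Defs where

open import Algebra.Bundles using (CommutativeRing)
import Algebra.Definitions.RawMonoid
open import Data.Fin using (Fin; _≟_)
open import Data.List using (List; []; _∷_; _++_; map; filter; foldl; foldr)
import Data.List.Extrema
import Data.List.Membership.DecPropositional
open import Data.List.Membership.Propositional using (_∈_)
open import Data.List.Relation.Binary.Subset.Propositional using (_⊆_)
open import Data.List.Relation.Unary.All using (All)
open import Data.List.Relation.Unary.Any using (Any; here; there)
open import Data.List.Relation.Unary.Linked using (Linked)
open import Data.List.Relation.Unary.Unique.Propositional using (Unique)
open import Data.Nat using (ℕ)
open import Data.Product using (_×_; _,_; ∃)
open import Function.Metric.Structures using (IsGeneralMetric)
open import Level using (Level; suc; _⊔_)
open import Relation.Binary.Bundles using (TotalOrder)
open import Relation.Binary.Core using (Rel)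
open import Relation.Binary.PropositionalEquality using (_≡_)
open import Relation.Binary.Structures using (IsDecTotalOrder)
open import Relation.Nullary using (¬_; ¬?)
open import Relation.Unary using (Pred)

-- The standard library has no real numbers.  Distances, times and costs take
-- values in an arbitrary totally ordered field; ℝ (classically) and ℚ are
-- instances.
record OrderedField (c ℓ₁ ℓ₂ : Level) : Set (suc (c ⊔ ℓ₁ ⊔ ℓ₂)) where
  field
    commutativeRing : CommutativeRing c ℓ₁
  open CommutativeRing commutativeRing public
    hiding (isEquivalence; refl; sym; trans; reflexive; isPartialEquivalence; setoid)
  infix 4 _≤_
  infix 8 _⁻¹
  field
    _≤_             : Rel Carrier ℓ₂
    isDecTotalOrder : IsDecTotalOrder _≈_ _≤_
    +-monoˡ-≤       : ∀ z {x y} → x ≤ y → x + z ≤ y + z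
    *-nonNegative   : ∀ {x y} → 0# ≤ x → 0# ≤ y → 0# ≤ x * y
    0≉1             : ¬ 0# ≈ 1#
    -- The inverse is total; its value at 0# is unconstrained and never used.
    _⁻¹             : Carrier → Carrier
    ⁻¹-inverse      : ∀ {x} → ¬ x ≈ 0# → x * x ⁻¹ ≈ 1#

  open IsDecTotalOrder isDecTotalOrder public
    using (_≤?_; isTotalOrder; isPartialOrder; isEquivalence)

  totalOrder : TotalOrder c ℓ₁ ℓ₂
  totalOrder = record { isTotalOrder = isTotalOrder }

  ½ : Carrier
  ½ = (1# + 1#) ⁻¹

  infixr 8 _·_
  _·_ : ℕ → Carrier → Carrier
  _·_ = Algebra.Definitions.RawMonoid._×_ +-rawMonoid

  module _ {ℓ : Level} (S : Pred Carrier ℓ) where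

    IsLeast : Carrier → Set (c ⊔ ℓ₂ ⊔ ℓ)
    IsLeast x = S x × (∀ y → S y → x ≤ y)

    IsGreatest : Carrier → Set (c ⊔ ℓ₂ ⊔ ℓ)
    IsGreatest x = S x × (∀ y → S y → y ≤ x)

    IsLowerBound : Carrier → Set (c ⊔ ℓ₂ ⊔ ℓ)
    IsLowerBound x = ∀ y → S y → x ≤ y

  IsInfimum : {ℓ : Level} → Pred Carrier ℓ → Carrier → Set (c ⊔ ℓ₂ ⊔ ℓ)
  IsInfimum S = IsGreatest (IsLowerBound S)

record FiniteMetricSpace {c ℓ₁ ℓ₂ : Level} (K : OrderedField c ℓ₁ ℓ₂)
                         : Set (c ⊔ ℓ₁ ⊔ ℓ₂) where
  open OrderedField K
  field
    size     : ℕ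
    d        : Fin size → Fin size → Carrier
    isMetric : IsGeneralMetric _≡_ _≈_ _≤_ 0# _+_ d

  Point : Set
  Point = Fin size

module OnlineService {c ℓ₁ ℓ₂ : Level} (K : OrderedField c ℓ₁ ℓ₂)
                     (M : FiniteMetricSpace K) where

  open OrderedField K
  open FiniteMetricSpace M
  open Data.List.Extrema totalOrder using (max)
  open Data.List.Membership.DecPropositional (_≟_ {size}) using (_∈?_)

  Time : Set c
  Time = Carrier

  record Request : Set (c ⊔ ℓ₂) where
    field
      arrival     : Time
      location    : Point
      nonNegative : 0# ≤ arrival

  open Request public using (arrival; location)

  -- A list rather than a set, so that distinct request occurrences may agree in
  -- both arrival time and location.
  Input : Set (c ⊔ ℓ₂)
  Input = List Request

  -- A walk (v₀, …, v_ℓ) is stored as the list of v₁, …, v_ℓ; its first vertex v₀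
  -- is always the current server position.
  Walk : Set
  Walk = List Point

  len : Point → Walk → Carrier
  len v []      = 0#
  len v (w ∷ P) = d v w + len w P

  endpoint : Point → Walk → Point
  endpoint v []      = v
  endpoint v (w ∷ P) = endpoint w P

  record Action : Set c where
    constructor _▹_
    field
      time  : Time
      walks : List Walk

  open Action public using (time; walks)

  Schedule : Set c
  Schedule = List Action

  ----------------------------------------------------------------------
  -- Automatic service

  record State : Set (c ⊔ ℓ₂) where
    field
      position : Point
      pending  : List Request
      upcoming : List Request
      spent    : Carrier

  open State public

  initial : Point → Input → State
  initial s₀ I = record { position = s₀ ; pending = [] ; upcoming = I ; spent = 0# }

  -- The server does not move between two actions, so all the epochs up to the
  -- next action meet the same server position.
  receive : Time → State → State
  receive t σ = record σ
    { pending  = pending σ ++ filter (λ q → ¬? (location q ≟ position σ))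
                                     (filter (λ q → arrival q ≤? t) (upcoming σ))
    ; upcoming = filter (λ q → ¬? (arrival q ≤? t)) (upcoming σ)
    }

  -- Delays of pending requests are nonnegative, so starting the maximum at 0# is
  -- harmless; it gives 0# when no request is served.
  maxDelay : Time → List Request → Carrier
  maxDelay t B = max 0# (map (λ q → t - arrival q) B)

  perform : Time → State → Walk → State
  perform t σ P = record σ
    { position = endpoint (position σ) P
    ; pending  = filter (λ q → ¬? (location q ∈? position σ ∷ P)) (pending σ)
    ; spent    = spent σ + (len (position σ) P + maxDelay t served)
    }
    where
    served : List Request
    served = filter (λ q → location q ∈? position σ ∷ P) (pending σ)

  act : State → Action → State
  act σ (t ▹ Ps) = foldl (perform t) (receive t σ) Ps

  execute : Point → Input → Schedule → State
  execute s₀ I = foldl act (initial s₀ I)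

  cost : Point → Input → Schedule → Carrier
  cost s₀ I S = spent (execute s₀ I S)

  record Feasible (s₀ : Point) (I : Input) (S : Schedule) : Set (c ⊔ ℓ₂) where
    field
      nonNegativeTimes   : All (λ α → 0# ≤ time α) S
      nondecreasingTimes : Linked (λ α β → time α ≤ time β) S
      pendingServed      : pending (execute s₀ I S) ≡ []
      -- Requests arriving after the last action are served only if they arrive
      -- at the final server position.
      upcomingServed     : All (λ q → location q ≡ position (execute s₀ I S))
                               (upcoming (execute s₀ I S))

  IsOPT : Point → Input → Carrier → Set (c ⊔ ℓ₁ ⊔ ℓ₂)
  IsOPT s₀ I = IsInfimum (λ v → ∃ λ S → Feasible s₀ I S × cost s₀ I S ≈ v)

  ----------------------------------------------------------------------
  -- Trees

  -- A tree in the complete graph is presented by a choice of root and of an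
  -- order on the children of each vertex; being a tree means that the vertices
  -- listed are pairwise distinct.  Vertex set, edge set and weight do not depend
  -- on the presentation.
  data Tree : Set where
    node : Point → List Tree → Tree

  root : Tree → Point
  root (node v _) = v

  vertices     : Tree → List Point
  verticesList : List Tree → List Point
  vertices (node v Fs)    = v ∷ verticesList Fs
  verticesList []         = []
  verticesList (F ∷ Fs)   = vertices F ++ verticesList Fs

  edges     : Tree → List (Point × Point)
  edgesFrom : Point → List Tree → List (Point × Point)
  edges (node v Fs)    = edgesFrom v Fs
  edgesFrom v []       = []
  edgesFrom v (F ∷ Fs) = (v , root F) ∷ edges F ++ edgesFrom v Fs

  weight : Tree → Carrier
  weight F = foldr (λ (u , v) w → d u v + w) 0# (edges F)

  -- Finite sets of points are given by lists, of which only the members matter.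
  SteinerTree : List Point → Tree → Set
  SteinerTree A F = Unique (vertices F) × A ⊆ vertices F

  SpanningTree : List Point → Tree → Set
  SpanningTree A F = Unique (vertices F) × A ⊆ vertices F × vertices F ⊆ A

  IsST : List Point → Carrier → Set (c ⊔ ℓ₁ ⊔ ℓ₂)
  IsST A = IsLeast (λ w → ∃ λ F → SteinerTree A F × weight F ≈ w)

  IsMST : List Point → Carrier → Set (c ⊔ ℓ₁ ⊔ ℓ₂)
  IsMST A = IsLeast (λ w → ∃ λ F → SpanningTree A F × weight F ≈ w)

  -- An element of  x ∈ᵀ F  is the path in F from its root to the vertex x.
  data _∈ᵀ_ (x : Point) : Tree → Set where
    here  : ∀ {Fs} → x ∈ᵀ node x Fs
    there : ∀ {v Fs} → Any (x ∈ᵀ_) Fs → x ∈ᵀ node v Fs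

  depth     : ∀ {x} F → x ∈ᵀ F → Carrier
  depthFrom : ∀ {x} v Fs → Any (x ∈ᵀ_) Fs → Carrier
  depth (node v Fs) here         = 0#
  depth (node v Fs) (there i)    = depthFrom v Fs i
  depthFrom v (F ∷ Fs) (here i)  = d v (root F) + depth F i
  depthFrom v (F ∷ Fs) (there i) = depthFrom v Fs i

  -- Closed depth-first walk from the root, using every edge twice.
  closedDFS  : Tree → Walk
  excursions : Point → List Tree → Walk
  closedDFS (node v Fs) = excursions v Fs
  excursions v []       = []
  excursions v (F ∷ Fs) = root F ∷ closedDFS F ++ v ∷ excursions v Fs

  -- Open depth-first walk from the root to x: at each vertex of the tree path,
  -- the subtree containing x is entered last and never left.  Other orders of
  -- traversal come from other orderings of the children.
  openDFS     : ∀ {x} F → x ∈ᵀ F → Walk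
  openDFSFrom : ∀ {x} v Fs → Any (x ∈ᵀ_) Fs → Walk
  openDFS (node v Fs) here         = excursions v Fs
  openDFS (node v Fs) (there i)    = openDFSFrom v Fs i
  openDFSFrom v (F ∷ Fs) (here i)  = excursions v Fs ++ root F ∷ openDFS F i
  openDFSFrom v (F ∷ Fs) (there i) = root F ∷ closedDFS F ++ v ∷ openDFSFrom v Fs i

  ----------------------------------------------------------------------
  -- Phase algorithms

  -- In the next definitions s is the anchor and R consists of the requests that
  -- arrive after the previous trigger time.

  awayFrom : Point → List Request → List Request
  awayFrom s R = filter (λ q → ¬? (location q ≟ s)) R

  phaseRequests : Point → List Request → Time → List Request
  phaseRequests s R t = filter (λ q → arrival q ≤? t) (awayFrom s R)

  terminals : Point → List Request → Time → List Point
  terminals s R t = s ∷ map location (phaseRequests s R t)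

  IsPhaseStart : Point → List Request → Time → Set (c ⊔ ℓ₁ ⊔ ℓ₂)
  IsPhaseStart s R = IsLeast (λ u → ∃ λ q → q ∈ awayFrom s R × arrival q ≈ u)

  -- A : the sets A(u);  threshold A α t v : θ(t) = v in the phase started at α;
  -- choice P A(t) F p i : F and p ∈ P may be used at the trigger, i being the
  -- path in F from its root to the location of p.
  record PhaseRule : Set (suc (c ⊔ ℓ₁ ⊔ ℓ₂)) where
    field
      threshold : (A : Time → List Point) (α t : Time) → Carrier → Set (c ⊔ ℓ₁ ⊔ ℓ₂)
      choice    : List Request → List Point →
                  (F : Tree) (p : Request) → location p ∈ᵀ F → Set (c ⊔ ℓ₁ ⊔ ℓ₂)

  module _ (rule : PhaseRule) where
    open PhaseRule rule

    IsTrigger : Point → List Request → Time → Time → Set (c ⊔ ℓ₁ ⊔ ℓ₂)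
    IsTrigger s R α = IsLeast (λ t → α ≤ t ×
      ∃ λ v → threshold (terminals s R) α t v × v ≤ t - α)

    -- PhaseRun s R S: with the server parked at s and the requests R to come, the
    -- algorithm may, depending on how ties are broken, perform the schedule S.
    data PhaseRun (s : Point) (R : List Request) : Schedule → Set (c ⊔ ℓ₁ ⊔ ℓ₂) where
      idle  : awayFrom s R ≡ [] → PhaseRun s R []
      phase : ∀ {α t F p S} →
              IsPhaseStart s R α →
              IsTrigger s R α t →
              p ∈ phaseRequests s R t →
              root F ≡ s →
              (i : location p ∈ᵀ F) →
              choice (phaseRequests s R t) (terminals s R t) F p i →
              PhaseRun (location p) (filter (λ q → ¬? (arrival q ≤? t)) R) S →
              PhaseRun s R ((t ▹ (openDFS F i ∷ [])) ∷ S)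

  exactSteiner : PhaseRule
  exactSteiner = record
    { threshold = λ A α t v → IsST (A t) v
    ; choice    = λ P A F p i →
        SteinerTree A F × IsST A (weight F) ×
        (∀ q → q ∈ P → (j : location q ∈ᵀ F) → depth F j ≤ depth F i)
    }

  terminalMST : PhaseRule
  terminalMST = record
    { threshold = λ A α t v → ∃ λ w →
        IsGreatest (λ m → ∃ λ u → α ≤ u × u ≤ t × IsMST (A u) m) w × v ≈ ½ * w
    ; choice    = λ P A F p i → SpanningTree A F × IsMST A (weight F)
    }

{-# OPTIONS --safe #-}

-- Let a phase start at α and trigger at t with threshold θ.  Since θ does not
-- decrease during a phase, the trigger comes exactly at t = α + θ, and the phase
-- costs at most κθ, with κ = 3 for the Steiner rule and κ = 5 for the MST rule.
-- At time β = α + θ/2 the test has not succeeded, so the threshold at β is at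
-- least θ/2.  Consider any offline schedule at time t.  If a request that arrived
-- by β is still pending, then it waits throughout [β, t], an interval of length θ/2.
-- Otherwise the offline walk since the start of the previous phase has visited
-- the anchor and all locations requested by β, and shortcutting it to a path on
-- these points shows that its length is at least θ/2.  The offline walks of the
-- phases are counted twice and the waiting times once, so Σ θ/2 is at most twice
-- the offline cost, and the ratio is 4κ.
--
-- Automatic service does not affect the argument: a request that is served for
-- free at the position of the offline server lies on the offline walk all the same.

module Submission where

open import Defs
open import Algebra.Bundles using (CommutativeRing)
import Algebra.Properties.Semiring.Mult
import Algebra.Solver.CommutativeMonoid
import Algebra.Solver.Ring.NaturalCoefficients.Default
open import Data.Empty using (⊥-elim)
open import Data.Fin using (Fin; zero; suc; _≟_)
open import Data.Fin.Properties using (injective⇒≤)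
open import Data.List
  using (List; []; _∷_; _++_; length; lookup; allFin; cartesianProduct;
         cartesianProductWith; filter; foldr; map; concat; foldl)
import Data.List.Extrema
import Data.List.Membership.DecPropositional
open import Data.List.Membership.Propositional using (_∈_; _∉_; lose; find)
open import Data.List.Membership.Propositional.Properties
  using (∈-++⁺ˡ; ∈-++⁺ʳ; ∈-++⁻; ∈-lookup; ∈-allFin; ∈-cartesianProduct⁺;
         ∈-cartesianProductWith⁺; ∈-filter⁺; ∈-filter⁻; ∈-map⁺; ∈-map⁻)
open import Data.List.Properties
  using (++-assoc; ++-identityʳ; length-++; filter-notAll; foldl-++; filter-none)
open import Data.List.Relation.Binary.Permutation.Propositional
  using (_↭_; ↭-refl; ↭-sym; ↭-trans; ↭-reflexive; ↭⇒↭ₛ; prep)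
open import Data.List.Relation.Binary.Permutation.Propositional.Properties
  using (∈-resp-↭; ++-commutativeMonoid)
import Data.List.Relation.Binary.Permutation.Setoid.Properties
open import Data.List.Relation.Binary.Sublist.Propositional using ([]; _∷_; _∷ʳ_) renaming (_⊆_ to _⊑_)
open import Data.List.Relation.Binary.Subset.Propositional using (_⊆_)
open import Data.List.Relation.Unary.All as All using (All; []; _∷_)
import Data.List.Relation.Unary.All.Properties as All
open import Data.List.Relation.Unary.AllPairs using ([]; _∷_; AllPairs)
open import Data.List.Relation.Unary.Any using (Any; here; there; any?)
open import Data.List.Relation.Unary.Linked.Properties using (AllPairs⇒Linked; Linked⇒AllPairs)
import Data.List.Relation.Unary.Unique.DecPropositional
open import Data.List.Relation.Unary.Unique.Propositional using (Unique)
open import Data.List.Relation.Unary.Unique.Propositional.Properties using (Unique[x∷xs]⇒x∉xs)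
open import Data.Nat as ℕ using (ℕ)
import Data.Nat.Properties as ℕ
open import Data.Product using (_×_; _,_; ∃; proj₁; proj₂)
open import Data.Sum as Sum using (_⊎_; inj₁; inj₂)
open import Function using (_∘_; id)
open import Function.Metric.Structures using (IsGeneralMetric)
open import Level using (Level; _⊔_)
open import Relation.Binary.Bundles using (Poset)
open import Relation.Binary.PropositionalEquality as ≡ using (_≡_; refl; cong; subst; _≢_; cong₂)
import Relation.Binary.Reasoning.PartialOrder
open import Relation.Binary.Structures using (IsDecTotalOrder)
open import Relation.Nullary using (¬_; yes; no; Dec; ¬?; contradiction)
open import Relation.Nullary.Decidable using (_×-dec_; decidable-stable)
open import Relation.Unary using (Pred; Decidable)

-- The constants `κ` count a doubled tree plus a delay of one threshold. The Steiner tree weighs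
-- `θ`, which gives 2 + 1; the envelope is halved in the other rule, so the spanning tree may weigh
-- `2θ`, which gives 4 + 1.
--
-- Offline delays resist a direct charge: a service event pays only for its longest delay, and one
-- request may stay pending over several phases. The accounting therefore follows `committed`, the
-- cost spent plus the longest delay accumulated so far by a pending request. The anchor is the
-- other obstacle, as the offline server need not come near it during the current phase. But the
-- anchor is `s₀`, where the offline walk starts, or a location requested in the preceding phase;
-- hence it was visited during that phase or a request there is still pending. This is the invariant
-- carried from phase to phase.
--
-- The theorem also asserts that runs exist. An ordered field need not be complete, so minimum
-- trees, thresholds and trigger times are obtained as extrema of finite lists.

module OrderedFieldProperties {c ℓ₁ ℓ₂ : Level} (K : OrderedField c ℓ₁ ℓ₂) where

  open OrderedField K
  open IsDecTotalOrder isDecTotalOrder public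
    using (antisym; total)
    renaming (refl to ≤-refl; trans to ≤-trans; reflexive to ≤-reflexive)
  open IsDecTotalOrder.Eq isDecTotalOrder public
    using () renaming (reflexive to ≈-reflexive; refl to ≈-refl; sym to ≈-sym; trans to ≈-trans)

  poset : Poset c ℓ₁ ℓ₂
  poset = record { isPartialOrder = isPartialOrder }

  open Relation.Binary.Reasoning.PartialOrder poset public
  module Solver = Algebra.Solver.Ring.NaturalCoefficients.Default
    (CommutativeRing.commutativeSemiring commutativeRing)
  open Solver using (solve; _:=_; _:+_; _:*_; con)
  open Algebra.Properties.Semiring.Mult semiring using (×-assoc-*; ×-congʳ)

  -- Arithmetic and inequalities in an ordered field.

  x-y+y≈x : ∀ x y → (x - y) + y ≈ x
  x-y+y≈x x y = ≈-trans (+-assoc x (- y) y)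
    (≈-trans (+-congˡ (-‿inverseˡ y)) (+-identityʳ x))

  +-mono-≤ : ∀ {w x y z} → w ≤ x → y ≤ z → w + y ≤ x + z
  +-mono-≤ {w} {x} {y} {z} w≤x y≤z = begin
    w + y ≤⟨ +-monoˡ-≤ y w≤x ⟩
    x + y ≈⟨ +-comm x y ⟩
    y + x ≤⟨ +-monoˡ-≤ x y≤z ⟩
    z + x ≈⟨ +-comm z x ⟩
    x + z ∎

  +-monoʳ-≤ : ∀ x {y z} → y ≤ z → x + y ≤ x + z
  +-monoʳ-≤ x y≤z = +-mono-≤ ≤-refl y≤z

  +-cancelʳ-≤ : ∀ z {x y} → x + z ≤ y + z → x ≤ y
  +-cancelʳ-≤ z {x} {y} x+z≤y+z = begin
    x             ≈⟨ lemma x ⟨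
    x + z + - z   ≤⟨ +-monoˡ-≤ (- z) x+z≤y+z ⟩
    y + z + - z   ≈⟨ lemma y ⟩
    y             ∎
    where
    lemma : ∀ w → w + z + - z ≈ w
    lemma w = ≈-trans (+-assoc w z (- z))
      (≈-trans (+-congˡ (-‿inverseʳ z)) (+-identityʳ w))

  -- A linear inequality between x and y follows from a sum a ≤ b of the
  -- hypotheses through an identity that contains no subtraction, which the
  -- semiring solver proves.
  ≤-from : ∀ {a b x y} → a ≤ b → x + b ≈ y + a → x ≤ y
  ≤-from {a} {b} {x} {y} a≤b eq = +-cancelʳ-≤ a (begin
    x + a ≤⟨ +-monoʳ-≤ x a≤b ⟩
    x + b ≈⟨ eq ⟩
    y + a ∎)

  x≤y+z⇒x-z≤y : ∀ {x y z} → x ≤ y + z → x - z ≤ y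
  x≤y+z⇒x-z≤y {x} {y} {z} h = +-cancelʳ-≤ z (≤-trans (≤-reflexive (x-y+y≈x x z)) h)

  x+z≤y⇒x≤y-z : ∀ {x y z} → x + z ≤ y → x ≤ y - z
  x+z≤y⇒x≤y-z {x} {y} {z} h = +-cancelʳ-≤ z (≤-trans h (≤-reflexive (≈-sym (x-y+y≈x y z))))

  x≤y-z⇒x+z≤y : ∀ {x y z} → x ≤ y - z → x + z ≤ y
  x≤y-z⇒x+z≤y {x} {y} {z} h = ≤-trans (+-monoˡ-≤ z h) (≤-reflexive (x-y+y≈x y z))

  x≤x+y : ∀ x {y} → 0# ≤ y → x ≤ x + y
  x≤x+y x {y} 0≤y = ≤-trans (≤-reflexive (≈-sym (+-identityʳ x))) (+-monoʳ-≤ x 0≤y)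

  x≤y+x : ∀ {y} x → 0# ≤ y → x ≤ y + x
  x≤y+x {y} x 0≤y = ≤-trans (x≤x+y x 0≤y) (≤-reflexive (+-comm x y))

  0≤x+y : ∀ {x y} → 0# ≤ x → 0# ≤ y → 0# ≤ x + y
  0≤x+y {x} 0≤x 0≤y = ≤-trans 0≤x (x≤x+y x 0≤y)

  *-monoʳ-≤ : ∀ {z x y} → 0# ≤ z → x ≤ y → z * x ≤ z * y
  *-monoʳ-≤ {z} {x} {y} 0≤z x≤y = begin
    z * x               ≤⟨ x≤y+x (z * x) (*-nonNegative 0≤z 0≤y-x) ⟩
    z * (y - x) + z * x ≈⟨ distribˡ z (y - x) x ⟨
    z * ((y - x) + x)   ≈⟨ *-congˡ (x-y+y≈x y x) ⟩
    z * y               ∎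
    where
    0≤y-x : 0# ≤ y - x
    0≤y-x = x+z≤y⇒x≤y-z (≤-trans (≤-reflexive (+-identityˡ x)) x≤y)

  -- If 1 ≤ 0 then 0 ≤ -1, and 1 is nonnegative all the same, being (-1)².
  0≤1 : 0# ≤ 1#
  0≤1 with total 0# 1#
  ... | inj₁ 0≤1 = 0≤1
  ... | inj₂ 1≤0 = ≤-from (*-nonNegative 0≤-1 0≤-1) (begin-equality
    0# + - 1# * - 1#
      ≈⟨ +-congʳ (-‿inverseʳ 1#) ⟨
    1# + - 1# + - 1# * - 1#
      ≈⟨ solve 1 (λ m → con 1 :+ m :+ m :* m := con 1 :+ m :* (con 1 :+ m)) ≈-refl (- 1#) ⟩
    1# + - 1# * (1# + - 1#)
      ≈⟨ +-congˡ (*-congˡ (-‿inverseʳ 1#)) ⟩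
    1# + - 1# * 0#
      ≈⟨ +-congˡ (zeroʳ (- 1#)) ⟩
    1# + 0# ∎)
    where
    0≤-1 : 0# ≤ - 1#
    0≤-1 = ≤-from 1≤0 (≈-trans (+-identityˡ 0#) (≈-sym (-‿inverseˡ 1#)))

  0≤n·x : ∀ n {x} → 0# ≤ x → 0# ≤ n · x
  0≤n·x ℕ.zero    0≤x = ≤-refl
  0≤n·x (ℕ.suc n) 0≤x = 0≤x+y 0≤x (0≤n·x n 0≤x)

  0≉1+n : ∀ n → ¬ ℕ.suc n · 1# ≈ 0#
  0≉1+n n eq = 0≉1 (antisym 0≤1 (≤-trans (x≤x+y 1# (0≤n·x n 0≤1)) (≤-reflexive eq)))

  ⁻¹-nonNegative : ∀ {x} → 0# ≤ x → ¬ x ≈ 0# → 0# ≤ x ⁻¹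
  ⁻¹-nonNegative {x} 0≤x x≉0 with total 0# (x ⁻¹)
  ... | inj₁ 0≤x⁻¹ = 0≤x⁻¹
  ... | inj₂ x⁻¹≤0 = ⊥-elim (0≉1 (antisym 0≤1 (begin
    1#       ≈⟨ ⁻¹-inverse x≉0 ⟨
    x * x ⁻¹ ≤⟨ *-monoʳ-≤ 0≤x x⁻¹≤0 ⟩
    x * 0#   ≈⟨ zeroʳ x ⟩
    0#       ∎)))

  ·-*1# : ∀ n x → (n · 1#) * x ≈ n · x
  ·-*1# n x = ≈-trans (×-assoc-* n 1# x) (×-congʳ n (*-identityˡ x))

  -- The infimum need not be attained, so the bound on `x` is divided by `suc n`: the quotient is a
  -- lower bound of `S`, hence at most `y`, and multiplying back gives the claim.
  infimum-scaled : ∀ {ℓ} {S : Pred Carrier ℓ} {x y} n → IsInfimum S y →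
                   (∀ z → S z → x ≤ ℕ.suc n · z) → x ≤ ℕ.suc n · y
  infimum-scaled {S = S} {x} {y} n (_ , greatest) bound = begin
    x              ≈⟨ cancel ⟨
    N * (N ⁻¹ * x) ≤⟨ *-monoʳ-≤ 0≤N (greatest (N ⁻¹ * x) lower) ⟩
    N * y          ≈⟨ ·-*1# (ℕ.suc n) y ⟩
    ℕ.suc n · y    ∎
    where
    N : Carrier
    N = ℕ.suc n · 1#
    0≤N : 0# ≤ N
    0≤N = 0≤n·x (ℕ.suc n) 0≤1
    cancel : ∀ {w} → N * (N ⁻¹ * w) ≈ w
    cancel {w} = ≈-trans (≈-sym (*-assoc N (N ⁻¹) w))
      (≈-trans (*-congʳ (⁻¹-inverse (0≉1+n n))) (*-identityˡ w))
    lower : ∀ z → S z → N ⁻¹ * x ≤ z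
    lower z Sz = begin
      N ⁻¹ * x             ≤⟨ *-monoʳ-≤ (⁻¹-nonNegative 0≤N (0≉1+n n)) (bound z Sz) ⟩
      N ⁻¹ * (ℕ.suc n · z) ≈⟨ *-congˡ (·-*1# (ℕ.suc n) z) ⟨
      N ⁻¹ * (N * z)       ≈⟨ solve 3 (λ i m w → i :* (m :* w) := m :* (i :* w)) ≈-refl (N ⁻¹) N z ⟩
      N * (N ⁻¹ * z)       ≈⟨ cancel ⟩
      z                    ∎

  ½+½≈1 : ½ + ½ ≈ 1#
  ½+½≈1 = begin-equality
    ½ + ½           ≈⟨ solve 1 (λ h → h :+ h := (con 1 :+ con 1) :* h) ≈-refl ½ ⟩
    (1# + 1#) * ½   ≈⟨ ⁻¹-inverse (λ eq → 0≉1+n 1 (≈-trans (+-congˡ (+-identityʳ 1#)) eq)) ⟩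
    1#              ∎

  0≤½ : 0# ≤ ½
  0≤½ = ⁻¹-nonNegative (0≤x+y 0≤1 0≤1) λ eq → 0≉1+n 1 (≈-trans (+-congˡ (+-identityʳ 1#)) eq)

  ½x+½x≈x : ∀ x → ½ * x + ½ * x ≈ x
  ½x+½x≈x x = ≈-trans (≈-sym (distribʳ x ½ ½)) (≈-trans (*-congʳ ½+½≈1) (*-identityˡ x))

-- Lists without repetition.

unique-++⁻ : ∀ {a} {A : Set a} (xs : List A) {ys} → Unique (xs ++ ys) →
             Unique xs × Unique ys × (∀ {x} → x ∈ xs → x ∉ ys)
unique-++⁻ []       u        = [] , u , λ ()
unique-++⁻ (x ∷ xs) (x∉ ∷ u) with unique-++⁻ xs u
... | uxs , uys , disjoint =
  All.++⁻ˡ xs x∉ ∷ uxs , uys , λ where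
    (here refl) x∈ys → All.lookup (All.++⁻ʳ xs x∉) x∈ys refl
    (there x∈xs)     → disjoint x∈xs

unique⇒lookup-injective : ∀ {a} {A : Set a} {xs : List A} → Unique xs →
                          ∀ {i j} → lookup xs i ≡ lookup xs j → i ≡ j
unique⇒lookup-injective (_ ∷ _)  {zero}  {zero}  _  = refl
unique⇒lookup-injective {xs = _ ∷ xs} (x∉ ∷ _) {zero}  {suc j} eq = ⊥-elim (All.lookup x∉ (∈-lookup {xs = xs} j) eq)
unique⇒lookup-injective {xs = _ ∷ xs} (x∉ ∷ _) {suc i} {zero}  eq = ⊥-elim (All.lookup x∉ (∈-lookup {xs = xs} i) (≡.sym eq))
unique⇒lookup-injective (_ ∷ u)  {suc i} {suc j} eq = cong suc (unique⇒lookup-injective u eq)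

unique⇒length≤ : ∀ {n} {xs : List (Fin n)} → Unique xs → length xs ℕ.≤ n
unique⇒length≤ {xs = xs} u = injective⇒≤ {f = lookup xs} (unique⇒lookup-injective u)

Unique-resp-↭ : ∀ {a} {A : Set a} {xs ys : List A} → xs ↭ ys → Unique xs → Unique ys
Unique-resp-↭ {A = A} = Data.List.Relation.Binary.Permutation.Setoid.Properties.Unique-resp-↭ (≡.setoid A) ∘ ↭⇒↭ₛ

module Competitive {c ℓ₁ ℓ₂ : Level} (K : OrderedField c ℓ₁ ℓ₂) (M : FiniteMetricSpace K) where

  open OrderedField K
  open OrderedFieldProperties K
  open Solver using (solve; _:=_; _:+_; _:*_; con)
  open FiniteMetricSpace M
  open OnlineService K M
  open Data.List.Membership.DecPropositional (_≟_ {size}) using (_∈?_)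
  open IsGeneralMetric isMetric using (triangle) renaming (nonNegative to d-nonNegative; sym to d-sym)

  -- Walks

  len-nonNegative : ∀ v P → 0# ≤ len v P
  len-nonNegative v []      = ≤-refl
  len-nonNegative v (w ∷ P) = 0≤x+y d-nonNegative (len-nonNegative w P)

  endpoint-++ : ∀ v P Q → endpoint v (P ++ Q) ≡ endpoint (endpoint v P) Q
  endpoint-++ v []      Q = refl
  endpoint-++ v (w ∷ P) Q = endpoint-++ w P Q

  endpoint-∈ : ∀ v P → endpoint v P ∈ v ∷ P
  endpoint-∈ v []      = here refl
  endpoint-∈ v (w ∷ P) = there (endpoint-∈ w P)

  len-++ : ∀ v P Q → len v (P ++ Q) ≈ len v P + len (endpoint v P) Q
  len-++ v []      Q = ≈-sym (+-identityˡ _)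
  len-++ v (w ∷ P) Q = ≈-trans (+-congˡ (len-++ w P Q)) (≈-sym (+-assoc _ _ _))

  len-detour : ∀ u v P → len u P ≤ d u v + len v P
  len-detour u v []      = 0≤x+y d-nonNegative ≤-refl
  len-detour u v (w ∷ P) = begin
    d u w + len w P             ≤⟨ +-monoˡ-≤ (len w P) (triangle u v w) ⟩
    d u v + d v w + len w P     ≈⟨ +-assoc _ _ _ ⟩
    d u v + (d v w + len w P)   ∎

  len-⊑ : ∀ v {P Q} → P ⊑ Q → len v P ≤ len v Q
  len-⊑ v []                   = ≤-refl
  len-⊑ v (_∷ʳ_ {ys = Q} w P⊑Q) = ≤-trans (len-⊑ v P⊑Q) (len-detour v w Q)
  len-⊑ v (refl ∷ P⊑Q)         = +-monoʳ-≤ _ (len-⊑ _ P⊑Q)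

  -- A shortcut may skip the starting point as well; the first edge is then saved as a whole.
  len-∷⊑∷ : ∀ {u v P Q} → u ∷ P ⊑ v ∷ Q → len u P ≤ len v Q
  len-∷⊑∷ (refl ∷ P⊑Q)                 = len-⊑ _ P⊑Q
  len-∷⊑∷ (_∷ʳ_ {ys = w ∷ Q} _ uP⊑wQ)  = ≤-trans (len-∷⊑∷ uP⊑wQ) (x≤y+x _ d-nonNegative)

  -- Weights of trees.

  edgeSum : List (Point × Point) → Carrier
  edgeSum = foldr (λ (u , v) w → d u v + w) 0#

  edgeSum-++ : ∀ es es′ → edgeSum (es ++ es′) ≈ edgeSum es + edgeSum es′
  edgeSum-++ []       es′ = ≈-sym (+-identityˡ _)
  edgeSum-++ (e ∷ es) es′ = ≈-trans (+-congˡ (edgeSum-++ es es′)) (≈-sym (+-assoc _ _ _))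

  weight-∷ : ∀ v F Fs → weight (node v (F ∷ Fs)) ≈ d v (root F) + weight F + weight (node v Fs)
  weight-∷ v F Fs =
    ≈-trans (+-congˡ (edgeSum-++ (edges F) (edgesFrom v Fs))) (≈-sym (+-assoc _ _ _))

  weight-++ : ∀ v Fs Gs → weight (node v (Fs ++ Gs)) ≈ weight (node v Fs) + weight (node v Gs)
  weight-++ v []       Gs = ≈-sym (+-identityˡ _)
  weight-++ v (F ∷ Fs) Gs = begin-equality
    weight (node v (F ∷ Fs ++ Gs))
      ≈⟨ weight-∷ v F (Fs ++ Gs) ⟩
    d v (root F) + weight F + weight (node v (Fs ++ Gs))
      ≈⟨ +-congˡ (weight-++ v Fs Gs) ⟩
    d v (root F) + weight F + (weight (node v Fs) + weight (node v Gs))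
      ≈⟨ +-assoc _ _ _ ⟨
    d v (root F) + weight F + weight (node v Fs) + weight (node v Gs)
      ≈⟨ +-congʳ (weight-∷ v F Fs) ⟨
    weight (node v (F ∷ Fs)) + weight (node v Gs) ∎

  weight-nonNegative : ∀ F → 0# ≤ weight F
  weight-nonNegative F = go (edges F)
    where
    go : ∀ es → 0# ≤ edgeSum es
    go []       = ≤-refl
    go (e ∷ es) = 0≤x+y d-nonNegative (go es)

  -- Depth-first walks

  closedDFS-endpoint  : ∀ F → endpoint (root F) (closedDFS F) ≡ root F
  excursions-endpoint : ∀ v Fs → endpoint v (excursions v Fs) ≡ v
  closedDFS-endpoint (node v Fs) = excursions-endpoint v Fs
  excursions-endpoint v []       = refl
  excursions-endpoint v (F ∷ Fs) =
    ≡.trans (endpoint-++ (root F) (closedDFS F) _) (excursions-endpoint v Fs)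

  closedDFS-len  : ∀ F → len (root F) (closedDFS F) ≈ weight F + weight F
  excursions-len : ∀ v Fs → len v (excursions v Fs) ≈ weight (node v Fs) + weight (node v Fs)
  excursion-len  : ∀ v F P → len v (root F ∷ closedDFS F ++ v ∷ P) ≈
                   d v (root F) + weight F + (d v (root F) + weight F) + len v P
  closedDFS-len (node v Fs) = excursions-len v Fs
  excursions-len v []       = ≈-sym (+-identityˡ 0#)
  excursions-len v (F ∷ Fs) = begin-equality
    len v (excursions v (F ∷ Fs))
      ≈⟨ excursion-len v F (excursions v Fs) ⟩
    e + e + len v (excursions v Fs)
      ≈⟨ +-congˡ (excursions-len v Fs) ⟩
    e + e + (w + w)
      ≈⟨ solve 2 (λ e w → e :+ e :+ (w :+ w) := e :+ w :+ (e :+ w)) ≈-refl e w ⟩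
    e + w + (e + w)
      ≈⟨ +-cong (weight-∷ v F Fs) (weight-∷ v F Fs) ⟨
    weight (node v (F ∷ Fs)) + weight (node v (F ∷ Fs)) ∎
    where
    e = d v (root F) + weight F
    w = weight (node v Fs)
  excursion-len v F P = begin-equality
    δ + len (root F) (closedDFS F ++ v ∷ P)
      ≈⟨ +-congˡ (len-++ (root F) (closedDFS F) (v ∷ P)) ⟩
    δ + (len (root F) (closedDFS F) + (d (endpoint (root F) (closedDFS F)) v + len v P))
      ≡⟨ cong (λ r → δ + (len (root F) (closedDFS F) + (d r v + len v P))) (closedDFS-endpoint F) ⟩
    δ + (len (root F) (closedDFS F) + (d (root F) v + len v P))
      ≈⟨ +-congˡ (+-cong (closedDFS-len F) (+-congʳ (d-sym _ _))) ⟩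
    δ + (weight F + weight F + (δ + len v P))
      ≈⟨ solve 3 (λ δ w l → δ :+ (w :+ w :+ (δ :+ l)) := δ :+ w :+ (δ :+ w) :+ l) ≈-refl δ (weight F) (len v P) ⟩
    δ + weight F + (δ + weight F) + len v P ∎
    where δ = d v (root F)

  openDFS-len     : ∀ {x} F (i : x ∈ᵀ F) → len (root F) (openDFS F i) ≤ weight F + weight F
  openDFSFrom-len : ∀ {x} v Fs (i : Any (x ∈ᵀ_) Fs) →
                    len v (openDFSFrom v Fs i) ≤ weight (node v Fs) + weight (node v Fs)
  openDFS-len (node v Fs) here      = ≤-reflexive (excursions-len v Fs)
  openDFS-len (node v Fs) (there i) = openDFSFrom-len v Fs i
  openDFSFrom-len v (F ∷ Fs) (here i) = begin
    len v (excursions v Fs ++ root F ∷ openDFS F i)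
      ≈⟨ len-++ v (excursions v Fs) _ ⟩
    len v (excursions v Fs) + (d (endpoint v (excursions v Fs)) (root F) + len (root F) (openDFS F i))
      ≡⟨ cong (λ y → len v (excursions v Fs) + (d y (root F) + len (root F) (openDFS F i))) (excursions-endpoint v Fs) ⟩
    len v (excursions v Fs) + (δ + len (root F) (openDFS F i))
      ≤⟨ +-mono-≤ (≤-reflexive (excursions-len v Fs)) (+-monoʳ-≤ δ (openDFS-len F i)) ⟩
    w + w + (δ + (weight F + weight F))
      -- The edge towards `x` is walked only once; charging it twice gives a bound that does not
      -- depend on `x`.
      ≤⟨ x≤x+y _ d-nonNegative ⟩
    w + w + (δ + (weight F + weight F)) + δ
      ≈⟨ solve 3 (λ w δ f → w :+ w :+ (δ :+ (f :+ f)) :+ δ := δ :+ f :+ w :+ (δ :+ f :+ w)) ≈-refl w δ (weight F) ⟩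
    δ + weight F + w + (δ + weight F + w)
      ≈⟨ +-cong (weight-∷ v F Fs) (weight-∷ v F Fs) ⟨
    weight (node v (F ∷ Fs)) + weight (node v (F ∷ Fs)) ∎
    where
    δ = d v (root F)
    w = weight (node v Fs)
  openDFSFrom-len v (F ∷ Fs) (there i) = begin
    len v (root F ∷ closedDFS F ++ v ∷ openDFSFrom v Fs i)
      ≈⟨ excursion-len v F (openDFSFrom v Fs i) ⟩
    e + e + len v (openDFSFrom v Fs i)
      ≤⟨ +-monoʳ-≤ (e + e) (openDFSFrom-len v Fs i) ⟩
    e + e + (w + w)
      ≈⟨ solve 2 (λ e w → e :+ e :+ (w :+ w) := e :+ w :+ (e :+ w)) ≈-refl e w ⟩
    e + w + (e + w)
      ≈⟨ +-cong (weight-∷ v F Fs) (weight-∷ v F Fs) ⟨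
    weight (node v (F ∷ Fs)) + weight (node v (F ∷ Fs)) ∎
    where
    e = d v (root F) + weight F
    w = weight (node v Fs)

  openDFS-endpoint     : ∀ {x} F (i : x ∈ᵀ F) → endpoint (root F) (openDFS F i) ≡ x
  openDFSFrom-endpoint : ∀ {x} v Fs (i : Any (x ∈ᵀ_) Fs) → endpoint v (openDFSFrom v Fs i) ≡ x
  openDFS-endpoint (node v Fs) here      = excursions-endpoint v Fs
  openDFS-endpoint (node v Fs) (there i) = openDFSFrom-endpoint v Fs i
  openDFSFrom-endpoint v (F ∷ Fs) (here i)  =
    ≡.trans (endpoint-++ v (excursions v Fs) _) (openDFS-endpoint F i)
  openDFSFrom-endpoint v (F ∷ Fs) (there i) =
    ≡.trans (endpoint-++ (root F) (closedDFS F) _) (openDFSFrom-endpoint v Fs i)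

  closedDFS-visits  : ∀ F → vertices F ⊆ root F ∷ closedDFS F
  excursions-visits : ∀ v Fs → verticesList Fs ⊆ excursions v Fs
  closedDFS-visits (node v Fs) (here eq)   = here eq
  closedDFS-visits (node v Fs) (there x∈)  = there (excursions-visits v Fs x∈)
  excursions-visits v (F ∷ Fs) x∈ with ∈-++⁻ (vertices F) x∈
  ... | inj₁ x∈F  = ∈-++⁺ˡ (closedDFS-visits F x∈F)
  ... | inj₂ x∈Fs = ∈-++⁺ʳ (root F ∷ closedDFS F) (there (excursions-visits v Fs x∈Fs))

  openDFS-visits     : ∀ {x} F (i : x ∈ᵀ F) → vertices F ⊆ root F ∷ openDFS F i
  openDFSFrom-visits : ∀ {x} v Fs (i : Any (x ∈ᵀ_) Fs) → verticesList Fs ⊆ openDFSFrom v Fs i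
  openDFS-visits (node v Fs) i         (here eq)  = here eq
  openDFS-visits (node v Fs) here      (there x∈) = there (excursions-visits v Fs x∈)
  openDFS-visits (node v Fs) (there i) (there x∈) = there (openDFSFrom-visits v Fs i x∈)
  openDFSFrom-visits v (F ∷ Fs) i         x∈ with ∈-++⁻ (vertices F) x∈
  openDFSFrom-visits v (F ∷ Fs) (here i)  x∈ | inj₁ x∈F  = ∈-++⁺ʳ (excursions v Fs) (openDFS-visits F i x∈F)
  openDFSFrom-visits v (F ∷ Fs) (here i)  x∈ | inj₂ x∈Fs = ∈-++⁺ˡ (excursions-visits v Fs x∈Fs)
  openDFSFrom-visits v (F ∷ Fs) (there i) x∈ | inj₁ x∈F  = ∈-++⁺ˡ (closedDFS-visits F x∈F)
  openDFSFrom-visits v (F ∷ Fs) (there i) x∈ | inj₂ x∈Fs =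
    ∈-++⁺ʳ (root F ∷ closedDFS F) (there (openDFSFrom-visits v Fs i x∈Fs))

  -- Vertices and paths

  ∈-vertices⇒∈ᵀ     : ∀ {x} F → x ∈ vertices F → x ∈ᵀ F
  ∈-verticesList⇒∈ᵀ : ∀ {x} Fs → x ∈ verticesList Fs → Any (x ∈ᵀ_) Fs
  ∈-vertices⇒∈ᵀ (node v Fs) (here refl) = here
  ∈-vertices⇒∈ᵀ (node v Fs) (there x∈)  = there (∈-verticesList⇒∈ᵀ Fs x∈)
  ∈-verticesList⇒∈ᵀ (F ∷ Fs) x∈ with ∈-++⁻ (vertices F) x∈
  ... | inj₁ x∈F  = here (∈-vertices⇒∈ᵀ F x∈F)
  ... | inj₂ x∈Fs = there (∈-verticesList⇒∈ᵀ Fs x∈Fs)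

  ∈ᵀ⇒∈-vertices     : ∀ {x F} → x ∈ᵀ F → x ∈ vertices F
  ∈ᵀ⇒∈-verticesList : ∀ {x Fs} → Any (x ∈ᵀ_) Fs → x ∈ verticesList Fs
  ∈ᵀ⇒∈-vertices here      = here refl
  ∈ᵀ⇒∈-vertices (there i) = there (∈ᵀ⇒∈-verticesList i)
  ∈ᵀ⇒∈-verticesList (here i)              = ∈-++⁺ˡ (∈ᵀ⇒∈-vertices i)
  ∈ᵀ⇒∈-verticesList {Fs = F ∷ _} (there i) = ∈-++⁺ʳ (vertices F) (∈ᵀ⇒∈-verticesList i)

  -- Distinct vertices leave only one path to each point. The Steiner rule compares depths along
  -- arbitrary paths, and this makes the depth a function of the point alone.
  ∈ᵀ-irrelevant    : ∀ {x F} → Unique (vertices F) → (i j : x ∈ᵀ F) → i ≡ j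
  Any∈ᵀ-irrelevant : ∀ {x Fs} → Unique (verticesList Fs) → (i j : Any (x ∈ᵀ_) Fs) → i ≡ j
  ∈ᵀ-irrelevant u       here      here      = refl
  ∈ᵀ-irrelevant u       here      (there j) = ⊥-elim (Unique[x∷xs]⇒x∉xs u (∈ᵀ⇒∈-verticesList j))
  ∈ᵀ-irrelevant u       (there i) here      = ⊥-elim (Unique[x∷xs]⇒x∉xs u (∈ᵀ⇒∈-verticesList i))
  ∈ᵀ-irrelevant (_ ∷ u) (there i) (there j) = cong there (Any∈ᵀ-irrelevant u i j)
  Any∈ᵀ-irrelevant {Fs = F ∷ Fs} u i j with unique-++⁻ (vertices F) u
  Any∈ᵀ-irrelevant u (here i)  (here j)  | uF , _ , _ = cong here (∈ᵀ-irrelevant uF i j)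
  Any∈ᵀ-irrelevant u (here i)  (there j) | _ , _ , disjoint = ⊥-elim (disjoint (∈ᵀ⇒∈-vertices i) (∈ᵀ⇒∈-verticesList j))
  Any∈ᵀ-irrelevant u (there i) (here j)  | _ , _ , disjoint = ⊥-elim (disjoint (∈ᵀ⇒∈-vertices j) (∈ᵀ⇒∈-verticesList i))
  Any∈ᵀ-irrelevant u (there i) (there j) | _ , uFs , _ = cong there (Any∈ᵀ-irrelevant uFs i j)

  -- Change of root

  -- The trees Gs collect what has been passed on the way down; they hang from
  -- the root of the subtree in which x is still to be reached.
  reroot     : ∀ {x} F → x ∈ᵀ F → List Tree → Tree
  rerootFrom : ∀ {x} v Fs → Any (x ∈ᵀ_) Fs → List Tree → Tree
  reroot (node v Fs) here      Gs = node v (Gs ++ Fs)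
  reroot (node v Fs) (there i) Gs = rerootFrom v Fs i Gs
  rerootFrom v (F ∷ Fs) (here i)  Gs = reroot F i (node v (Gs ++ Fs) ∷ [])
  rerootFrom v (F ∷ Fs) (there i) Gs = rerootFrom v Fs i (F ∷ Gs)

  root-reroot     : ∀ {x} F (i : x ∈ᵀ F) Gs → root (reroot F i Gs) ≡ x
  root-rerootFrom : ∀ {x} v Fs (i : Any (x ∈ᵀ_) Fs) Gs → root (rerootFrom v Fs i Gs) ≡ x
  root-reroot (node v Fs) here      Gs = refl
  root-reroot (node v Fs) (there i) Gs = root-rerootFrom v Fs i Gs
  root-rerootFrom v (F ∷ Fs) (here i)  Gs = root-reroot F i (node v (Gs ++ Fs) ∷ [])
  root-rerootFrom v (F ∷ Fs) (there i) Gs = root-rerootFrom v Fs i (F ∷ Gs)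

  weight-reroot     : ∀ {x} F (i : x ∈ᵀ F) Gs →
                      weight (reroot F i Gs) ≈ weight F + weight (node (root F) Gs)
  weight-rerootFrom : ∀ {x} v Fs (i : Any (x ∈ᵀ_) Fs) Gs →
                      weight (rerootFrom v Fs i Gs) ≈ weight (node v Fs) + weight (node v Gs)
  weight-reroot (node v Fs) here      Gs = ≈-trans (weight-++ v Gs Fs) (+-comm _ _)
  weight-reroot (node v Fs) (there i) Gs = weight-rerootFrom v Fs i Gs
  weight-rerootFrom v (F ∷ Fs) (here i) Gs = begin-equality
    weight (reroot F i (node v (Gs ++ Fs) ∷ []))
      ≈⟨ weight-reroot F i _ ⟩
    weight F + weight (node (root F) (node v (Gs ++ Fs) ∷ []))
      ≈⟨ +-congˡ (weight-∷ (root F) (node v (Gs ++ Fs)) []) ⟩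
    weight F + (d (root F) v + weight (node v (Gs ++ Fs)) + 0#)
      ≈⟨ +-congˡ (+-congʳ (+-cong (d-sym _ _) (weight-++ v Gs Fs))) ⟩
    weight F + (d v (root F) + (weight (node v Gs) + weight (node v Fs)) + 0#)
      ≈⟨ solve 4 (λ f δ g h → f :+ (δ :+ (g :+ h) :+ con 0) := δ :+ f :+ h :+ g) ≈-refl
           (weight F) (d v (root F)) (weight (node v Gs)) (weight (node v Fs)) ⟩
    d v (root F) + weight F + weight (node v Fs) + weight (node v Gs)
      ≈⟨ +-congʳ (weight-∷ v F Fs) ⟨
    weight (node v (F ∷ Fs)) + weight (node v Gs) ∎
  weight-rerootFrom v (F ∷ Fs) (there i) Gs = begin-equality
    weight (rerootFrom v Fs i (F ∷ Gs))
      ≈⟨ weight-rerootFrom v Fs i (F ∷ Gs) ⟩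
    weight (node v Fs) + weight (node v (F ∷ Gs))
      ≈⟨ +-congˡ (weight-∷ v F Gs) ⟩
    weight (node v Fs) + (d v (root F) + weight F + weight (node v Gs))
      ≈⟨ solve 3 (λ e h g → h :+ (e :+ g) := e :+ h :+ g) ≈-refl
           (d v (root F) + weight F) (weight (node v Fs)) (weight (node v Gs)) ⟩
    d v (root F) + weight F + weight (node v Fs) + weight (node v Gs)
      ≈⟨ +-congʳ (weight-∷ v F Fs) ⟨
    weight (node v (F ∷ Fs)) + weight (node v Gs) ∎

  verticesList-++ : ∀ Fs Gs → verticesList (Fs ++ Gs) ≡ verticesList Fs ++ verticesList Gs
  verticesList-++ []       Gs = refl
  verticesList-++ (F ∷ Fs) Gs = ≡.trans (cong (vertices F ++_) (verticesList-++ Fs Gs))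
    (≡.sym (++-assoc (vertices F) _ _))

  open Algebra.Solver.CommutativeMonoid (++-commutativeMonoid {A = Point}) using (_⊕_; _⊜_)
    renaming (solve to solve-↭; id to ε)

  vertices-reroot     : ∀ {x} F (i : x ∈ᵀ F) Gs → vertices (reroot F i Gs) ↭ vertices F ++ verticesList Gs
  vertices-rerootFrom : ∀ {x} v Fs (i : Any (x ∈ᵀ_) Fs) Gs →
                        vertices (rerootFrom v Fs i Gs) ↭ v ∷ verticesList Fs ++ verticesList Gs
  vertices-reroot (node v Fs) here      Gs rewrite verticesList-++ Gs Fs =
    prep v (solve-↭ 2 (λ g f → g ⊕ f ⊜ f ⊕ g) ↭-refl (verticesList Gs) (verticesList Fs))
  vertices-reroot (node v Fs) (there i) Gs = vertices-rerootFrom v Fs i Gs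
  vertices-rerootFrom v (F ∷ Fs) (here i) Gs =
    ↭-trans (vertices-reroot F i _) (↭-trans
      (↭-reflexive (cong (λ vs → vertices F ++ (v ∷ vs) ++ []) (verticesList-++ Gs Fs)))
      (solve-↭ 4 (λ p f g h → f ⊕ ((p ⊕ (g ⊕ h)) ⊕ ε) ⊜ p ⊕ ((f ⊕ h) ⊕ g)) ↭-refl
        (v ∷ []) (vertices F) (verticesList Gs) (verticesList Fs)))
  vertices-rerootFrom v (F ∷ Fs) (there i) Gs =
    ↭-trans (vertices-rerootFrom v Fs i (F ∷ Gs))
      (solve-↭ 4 (λ p f g h → p ⊕ (h ⊕ (f ⊕ g)) ⊜ p ⊕ ((f ⊕ h) ⊕ g)) ↭-refl
        (v ∷ []) (vertices F) (verticesList Gs) (verticesList Fs))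

  -- Minimality ignores the presentation of a tree, but a phase traverses a tree whose root is the
  -- anchor.
  rerooted : ∀ {x} F → x ∈ vertices F → ∃ λ G → root G ≡ x × vertices G ↭ vertices F × weight G ≈ weight F
  rerooted F x∈F = reroot F i [] , root-reroot F i [] ,
    ↭-trans (vertices-reroot F i []) (↭-reflexive (++-identityʳ (vertices F))) ,
    ≈-trans (weight-reroot F i []) (+-identityʳ (weight F))
    where i = ∈-vertices⇒∈ᵀ F x∈F

  -- Minimum trees

  -- The list only has to be finite and to contain every forest with at most `n` vertices. The
  -- budget is therefore passed on undivided to the children and to the siblings, and larger forests
  -- or repeated vertices may occur.
  forests : ℕ → List (List Tree)
  forests ℕ.zero    = [] ∷ []
  forests (ℕ.suc n) = [] ∷ cartesianProductWith (λ (v , Fs) Gs → node v Fs ∷ Gs)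
    (cartesianProduct (allFin size) (forests n)) (forests n)

  ∈-forests : ∀ n Fs → length (verticesList Fs) ℕ.≤ n → Fs ∈ forests n
  ∈-forests ℕ.zero    []               _     = here refl
  ∈-forests ℕ.zero    (node _ _ ∷ _)   ()
  ∈-forests (ℕ.suc n) []               _     = here refl
  ∈-forests (ℕ.suc n) (node v Fs ∷ Gs) (ℕ.s≤s len≤n) = there
    (∈-cartesianProductWith⁺ (λ (v , Fs) Gs → node v Fs ∷ Gs)
      (∈-cartesianProduct⁺ (∈-allFin v) (∈-forests n Fs (ℕ.m+n≤o⇒m≤o (length (verticesList Fs)) len≤n′)))
      (∈-forests n Gs (ℕ.m+n≤o⇒n≤o (length (verticesList Fs)) len≤n′)))
    where
    len≤n′ : length (verticesList Fs) ℕ.+ length (verticesList Gs) ℕ.≤ n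
    len≤n′ = subst (ℕ._≤ n) (length-++ (verticesList Fs)) len≤n

  trees : List Tree
  trees = cartesianProductWith node (allFin size) (forests size)

  ∈-trees : ∀ {F} → Unique (vertices F) → F ∈ trees
  ∈-trees {node v Fs} u = ∈-cartesianProductWith⁺ node (∈-allFin v)
    (∈-forests size Fs (ℕ.≤-trans (ℕ.n≤1+n _) (unique⇒length≤ u)))

  module Extrema = Data.List.Extrema totalOrder

  abstract
    least : ∀ {a} {A : Set a} (f : A → Carrier) {x} {xs} → x ∈ xs →
            ∃ λ y → y ∈ xs × (∀ {z} → z ∈ xs → f y ≤ f z)
    least f {x} {xs} x∈xs = Extrema.argmin f x xs , y∈xs , All.lookup (Extrema.f[argmin]≤f[xs] x xs)
      where
      y∈xs : Extrema.argmin f x xs ∈ xs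
      y∈xs with Extrema.argmin-sel f x xs
      ... | inj₁ eq  rewrite eq = x∈xs
      ... | inj₂ y∈ = y∈

    greatest : ∀ {a} {A : Set a} (f : A → Carrier) {x} {xs} → x ∈ xs →
               ∃ λ y → y ∈ xs × (∀ {z} → z ∈ xs → f z ≤ f y)
    greatest f {x} {xs} x∈xs = Extrema.argmax f x xs , y∈xs , All.lookup (Extrema.f[xs]≤f[argmax] x xs)
      where
      y∈xs : Extrema.argmax f x xs ∈ xs
      y∈xs with Extrema.argmax-sel f x xs
      ... | inj₁ eq  rewrite eq = x∈xs
      ... | inj₂ y∈ = y∈

  -- The searches for Steiner and for spanning trees differ only in the condition on the vertex
  -- list. Decidability and distinctness make the search finite, and invariance under permutation
  -- lets a minimum tree be rerooted.
  record TreeKind (ℓ : Level) : Set (Level.suc ℓ) where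
    field
      Ok       : Pred (List Point) ℓ
      ok?      : Decidable Ok
      unique   : ∀ {vs} → Ok vs → Unique vs
      resp-↭   : ∀ {vs ws} → vs ↭ ws → Ok vs → Ok ws

  IsMinimum : ∀ {ℓ} → TreeKind ℓ → Carrier → Set _
  IsMinimum kind = IsLeast (λ w → ∃ λ F → TreeKind.Ok kind (vertices F) × weight F ≈ w)

  minimumTree : ∀ {ℓ} (kind : TreeKind ℓ) {F} → TreeKind.Ok kind (vertices F) →
                ∃ λ G → TreeKind.Ok kind (vertices G) × IsMinimum kind (weight G)
  minimumTree kind okF with least weight (∈-filter⁺ (TreeKind.ok? kind ∘ vertices) (∈-trees (TreeKind.unique kind okF)) okF)
  ... | G , G∈ , minimal = G , okG , (G , okG , ≈-refl) , λ w (H , okH , eq) → ≤-trans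
    (minimal (∈-filter⁺ (ok? ∘ vertices) (∈-trees (unique okH)) okH)) (≤-reflexive eq)
    where
    open TreeKind kind
    okG : Ok (vertices G)
    okG = proj₂ (∈-filter⁻ (ok? ∘ vertices) {xs = trees} G∈)

  minimumTreeFrom : ∀ {ℓ} (kind : TreeKind ℓ) {x F} →
                    (∀ {vs} → TreeKind.Ok kind vs → x ∈ vs) → TreeKind.Ok kind (vertices F) →
                    ∃ λ G → root G ≡ x × TreeKind.Ok kind (vertices G) × IsMinimum kind (weight G)
  minimumTreeFrom kind x∈ okF =
    let G , okG , _ , minimal = minimumTree kind okF
        H , root≡ , vs↭ , w≈ = rerooted G (x∈ okG)
        okH = resp-↭ (↭-sym vs↭) okG
    in H , root≡ , okH , (H , okH , ≈-refl) , λ w ok → ≤-trans (≤-reflexive w≈) (minimal w ok)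
    where open TreeKind kind

  subset? : ∀ A B → Dec (A ⊆ B)
  subset? A B with All.all? (_∈? B) A
  ... | yes A∈B = yes (All.lookup A∈B)
  ... | no ¬A∈B = no λ A⊆B → ¬A∈B (All.tabulate A⊆B)

  open Data.List.Relation.Unary.Unique.DecPropositional (_≟_ {size}) using (unique?)

  steinerKind spanningKind : List Point → TreeKind _
  steinerKind A = record
    { Ok     = λ vs → Unique vs × A ⊆ vs
    ; ok?    = λ vs → unique? vs ×-dec subset? A vs
    ; unique = proj₁
    ; resp-↭ = λ p (u , A⊆) → Unique-resp-↭ p u , ∈-resp-↭ p ∘ A⊆
    }
  spanningKind A = record
    { Ok     = λ vs → Unique vs × A ⊆ vs × vs ⊆ A
    ; ok?    = λ vs → unique? vs ×-dec subset? A vs ×-dec subset? vs A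
    ; unique = proj₁
    ; resp-↭ = λ p (u , A⊆ , ⊆A) → Unique-resp-↭ p u , ∈-resp-↭ p ∘ A⊆ , ⊆A ∘ ∈-resp-↭ (↭-sym p)
    }

  -- Spanning trees obtained by shortcutting walks.

  pathTree : Point → List Point → Tree
  pathTree v []      = node v []
  pathTree v (w ∷ P) = node v (pathTree w P ∷ [])

  root-pathTree : ∀ v P → root (pathTree v P) ≡ v
  root-pathTree v []      = refl
  root-pathTree v (w ∷ P) = refl

  vertices-pathTree : ∀ v P → vertices (pathTree v P) ≡ v ∷ P
  vertices-pathTree v []      = refl
  vertices-pathTree v (w ∷ P) = cong (v ∷_)
    (≡.trans (++-identityʳ (vertices (pathTree w P))) (vertices-pathTree w P))

  weight-pathTree : ∀ v P → weight (pathTree v P) ≈ len v P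
  weight-pathTree v []      = ≈-refl
  weight-pathTree v (w ∷ P) = begin-equality
    weight (node v (pathTree w P ∷ []))
      ≈⟨ weight-∷ v (pathTree w P) [] ⟩
    d v (root (pathTree w P)) + weight (pathTree w P) + 0#
      ≈⟨ +-identityʳ _ ⟩
    d v (root (pathTree w P)) + weight (pathTree w P)
      ≡⟨ cong (λ r → d v r + weight (pathTree w P)) (root-pathTree w P) ⟩
    d v w + weight (pathTree w P)
      ≈⟨ +-congˡ (weight-pathTree w P) ⟩
    d v w + len w P ∎

  -- The last occurrence in `W` of each member of `A` is kept: the tail is shortcut before the head,
  -- which is added only if it does not occur again.
  shortcut : ∀ A W → ∃ λ Q → Unique Q × Q ⊑ W × Q ⊆ A × (∀ {x} → x ∈ A → x ∈ W → x ∈ Q)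
  shortcut A [] = [] , [] , [] , (λ ()) , (λ _ x∈[] → x∈[])
  shortcut A (w ∷ W) with shortcut A W
  ... | Q , uQ , Q⊑W , Q⊆A , covers with w ∈? A | w ∈? Q
  ... | yes w∈A | no w∉Q = w ∷ Q , All.tabulate (λ x∈Q w≡x → w∉Q (subst (_∈ Q) (≡.sym w≡x) x∈Q)) ∷ uQ ,
    refl ∷ Q⊑W , (λ { (here refl) → w∈A ; (there x∈Q) → Q⊆A x∈Q }) ,
    λ { x∈A (here refl) → here refl ; x∈A (there x∈W) → there (covers x∈A x∈W) }
  ... | yes w∈A | yes w∈Q = Q , uQ , w ∷ʳ Q⊑W , Q⊆A ,
    λ { x∈A (here refl) → w∈Q ; x∈A (there x∈W) → covers x∈A x∈W }
  ... | no w∉A  | _ = Q , uQ , w ∷ʳ Q⊑W , Q⊆A ,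
    λ { x∈A (here refl) → ⊥-elim (w∉A x∈A) ; x∈A (there x∈W) → covers x∈A x∈W }

  -- The shortcut walk is a path without repetition and thus a tree as it stands, so the length
  -- bounds the weight with no loss of a factor.
  walk⇒spanningTree : ∀ {a A} v P → a ∷ A ⊆ v ∷ P →
                      ∃ λ F → SpanningTree (a ∷ A) F × weight F ≤ len v P
  walk⇒spanningTree {a} {A} v P A⊆P with shortcut (a ∷ A) (v ∷ P)
  -- Impossible: `a` itself is a terminal on the walk, so the shortcut retains it.
  ... | [] , _ , _ , _ , covers with covers (here refl) (A⊆P (here refl))
  ...   | ()
  walk⇒spanningTree {a} {A} v P A⊆P | u ∷ Q , uQ , Q⊑P , Q⊆A , covers =
    pathTree u Q ,
    subst (λ vs → Unique vs × a ∷ A ⊆ vs × vs ⊆ a ∷ A) (≡.sym (vertices-pathTree u Q))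
      (uQ , (λ x∈A → covers x∈A (A⊆P x∈A)) , Q⊆A) ,
    ≤-trans (≤-reflexive (weight-pathTree u Q)) (len-∷⊑∷ Q⊑P)

  spanning⇒steiner : ∀ {A F} → SpanningTree A F → SteinerTree A F
  spanning⇒steiner (u , A⊆ , _) = u , A⊆

  spanningTree : ∀ a A → ∃ (SpanningTree (a ∷ A))
  spanningTree a A with walk⇒spanningTree a A id
  ... | F , spanning , _ = F , spanning

  -- Phase rules

  ∈-phaseRequests⁺ : ∀ {s R t q} → q ∈ R → location q ≢ s → arrival q ≤ t → q ∈ phaseRequests s R t
  ∈-phaseRequests⁺ q∈R q≢s q≤t =
    ∈-filter⁺ (λ q → arrival q ≤? _) (∈-filter⁺ (λ q → ¬? (location q ≟ _)) q∈R q≢s) q≤t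

  ∈-phaseRequests⁻ : ∀ s R t {q} → q ∈ phaseRequests s R t → q ∈ R × location q ≢ s × arrival q ≤ t
  ∈-phaseRequests⁻ s R t q∈P =
    let q∈away , q≤t = ∈-filter⁻ (λ q → arrival q ≤? t) {xs = awayFrom s R} q∈P
        q∈R , q≢s    = ∈-filter⁻ (λ q → ¬? (location q ≟ s)) {xs = R} q∈away
    in q∈R , q≢s , q≤t

  terminals-⊆ : ∀ s R {t t′} → (∀ {q} → q ∈ R → arrival q ≤ t → arrival q ≤ t′) →
                terminals s R t ⊆ terminals s R t′
  terminals-⊆ s R later (here eq)  = here eq
  terminals-⊆ s R {t} later (there x∈) with ∈-map⁻ location x∈
  ... | q , q∈P , refl with ∈-phaseRequests⁻ s R t q∈P
  ... | q∈R , q≢s , q≤t = there (∈-map⁺ location (∈-phaseRequests⁺ q∈R q≢s (later q∈R q≤t)))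

  terminals-mono : ∀ s R {t t′} → t ≤ t′ → terminals s R t ⊆ terminals s R t′
  terminals-mono s R t≤t′ = terminals-⊆ s R (λ _ q≤t → ≤-trans q≤t t≤t′)

  -- Terminal sets change only at arrivals, so these times represent the whole interval from `α` to
  -- `t`. Listing `α` separately keeps the list nonempty.
  events : List Request → Time → Time → List Time
  events R α t = α ∷ filter (λ u → α ≤? u ×-dec u ≤? t) (map arrival R)

  ∈-events⁻ : ∀ {R α t e} → α ≤ t → e ∈ events R α t → α ≤ e × e ≤ t
  ∈-events⁻ α≤t (here refl) = ≤-refl , α≤t
  ∈-events⁻ {R} {α} {t} α≤t (there e∈) =
    proj₂ (∈-filter⁻ (λ u → α ≤? u ×-dec u ≤? t) {xs = map arrival R} e∈)

  ∈-events⁺ : ∀ {R α t q} → q ∈ R → α ≤ arrival q → arrival q ≤ t → arrival q ∈ events R α t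
  ∈-events⁺ q∈R α≤q q≤t = there (∈-filter⁺ (λ u → _ ≤? u ×-dec u ≤? _) (∈-map⁺ arrival q∈R) (α≤q , q≤t))

  -- The point of `e` is that nothing arrives after it up to `t`, so the terminals at `e` and at `t`
  -- agree.
  latestEvent : ∀ R α t → ∃ λ e → e ∈ events R α t × (∀ {q} → q ∈ R → arrival q ≤ t → arrival q ≤ e)
  latestEvent R α t with greatest id {xs = events R α t} (here refl)
  ... | e , e∈ , latest = e , e∈ , arrived
    where
    arrived : ∀ {q} → q ∈ R → arrival q ≤ t → arrival q ≤ e
    arrived {q} q∈R q≤t with total α (arrival q)
    ... | inj₁ α≤q = latest (∈-events⁺ q∈R α≤q q≤t)
    ... | inj₂ q≤α = ≤-trans q≤α (latest (here refl))

  -- The interface between a rule and the analysis. Monotonicity is stated for inclusion of terminal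
  -- sets, not for the order of times, so that it also bounds a later threshold by an earlier one
  -- when nothing has arrived in between. The walk in `threshold≤len` may start anywhere, since the
  -- offline server does not share the anchor.
  record Lawful (rule : PhaseRule) (κ : Carrier) : Set (Level.suc (c ⊔ ℓ₁ ⊔ ℓ₂)) where
    open PhaseRule rule
    field
      threshold-exists : ∀ s R {α t} → α ≤ t → ∃ λ v → threshold (terminals s R) α t v
      threshold-mono   : ∀ s R {α t t′ v v′} → α ≤ t → α ≤ t′ → terminals s R t ⊆ terminals s R t′ →
                         threshold (terminals s R) α t v → threshold (terminals s R) α t′ v′ → v ≤ v′
      threshold-nonNegative : ∀ s R {α t v} → threshold (terminals s R) α t v → 0# ≤ v
      threshold≤len    : ∀ s R {α t v} y W → terminals s R t ⊆ y ∷ W →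
                         threshold (terminals s R) α t v → v ≤ len y W
      phaseCost        : ∀ s R {α t v F p} {i : location p ∈ᵀ F} → α ≤ t →
                         threshold (terminals s R) α t v →
                         choice (phaseRequests s R t) (terminals s R t) F p i →
                         weight F + weight F + v ≤ κ * v
      choice-covers    : ∀ {P A F p} {i : location p ∈ᵀ F} → choice P A F p i → A ⊆ vertices F
      choice-exists    : ∀ s {P p₀} → p₀ ∈ P →
                         ∃ λ F → ∃ λ p → ∃ λ (i : location p ∈ᵀ F) →
                         p ∈ P × root F ≡ s × choice P (s ∷ map location P) F p i

  -- The exact-Steiner rule

  ST-exists : ∀ a A → ∃ (IsST (a ∷ A))
  ST-exists a A =
    let F , spanning = spanningTree a A
        G , _ , minimum = minimumTree (steinerKind (a ∷ A)) {F} (spanning⇒steiner {F = F} spanning)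
    in weight G , minimum

  ST-mono : ∀ {A B v w} → A ⊆ B → IsST A v → IsST B w → v ≤ w
  ST-mono {w = w} A⊆B (_ , minimal) ((F , (u , B⊆) , wF≈w) , _) = minimal w (F , (u , B⊆ ∘ A⊆B) , wF≈w)

  ST-nonNegative : ∀ {A v} → IsST A v → 0# ≤ v
  ST-nonNegative ((F , _ , wF≈v) , _) = ≤-trans (weight-nonNegative F) (≤-reflexive wF≈v)

  ST≤len : ∀ {a A v} y W → a ∷ A ⊆ y ∷ W → IsST (a ∷ A) v → v ≤ len y W
  ST≤len y W A⊆ (_ , minimal) =
    let F , spanning , wF≤ = walk⇒spanningTree y W A⊆
    in ≤-trans (minimal (weight F) (F , spanning⇒steiner {F = F} spanning , ≈-refl)) wF≤

  ST-phaseCost : ∀ {A v F} → IsST A v → IsST A (weight F) →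
                 weight F + weight F + v ≤ (1# + 1# + 1#) * v
  ST-phaseCost {v = v} {F} (attained , _) (_ , minimal) = begin
    weight F + weight F + v   ≤⟨ +-monoˡ-≤ v (+-mono-≤ wF≤v wF≤v) ⟩
    v + v + v                 ≈⟨ solve 1 (λ v → v :+ v :+ v := (con 1 :+ con 1 :+ con 1) :* v) ≈-refl v ⟩
    (1# + 1# + 1#) * v        ∎
    where
    wF≤v : weight F ≤ v
    wF≤v = minimal v attained

  -- A total function of the point, so that a farthest request can be selected as a maximiser over
  -- the list `P`.
  depthAt : (F : Tree) (x : Point) → Carrier
  depthAt F x with x ∈? vertices F
  ... | yes x∈ = depth F (∈-vertices⇒∈ᵀ F x∈)
  ... | no _   = 0#

  depthAt≡depth : ∀ {F x} → Unique (vertices F) → (i : x ∈ᵀ F) → depthAt F x ≡ depth F i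
  depthAt≡depth {F} {x} u i with x ∈? vertices F
  ... | yes x∈ = cong (depth F) (∈ᵀ-irrelevant u _ i)
  ... | no x∉  = ⊥-elim (x∉ (∈ᵀ⇒∈-vertices i))

  ST-choice-exists : ∀ s {P p₀} → p₀ ∈ P →
                     ∃ λ F → ∃ λ p → ∃ λ (i : location p ∈ᵀ F) →
                     p ∈ P × root F ≡ s × PhaseRule.choice exactSteiner P (s ∷ map location P) F p i
  ST-choice-exists s {P} p₀∈P =
    let F₀ , spanning = spanningTree s (map location P)
        F , root≡ , okF , minimum =
          minimumTreeFrom (steinerKind (s ∷ map location P)) {F = F₀} (λ ok → proj₂ ok (here refl))
            (spanning⇒steiner {F = F₀} spanning)
        p , p∈P , far = greatest (depthAt F ∘ location) p₀∈P
        i = ∈-vertices⇒∈ᵀ F (proj₂ okF (there (∈-map⁺ location p∈P)))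
    in F , p , i , p∈P , root≡ , okF , minimum ,
       λ q q∈P j → ≡.subst₂ _≤_ (depthAt≡depth (proj₁ okF) j) (depthAt≡depth (proj₁ okF) i) (far q∈P)

  exactSteiner-lawful : Lawful exactSteiner (1# + 1# + 1#)
  exactSteiner-lawful = record
    { threshold-exists      = λ s R {_} {t} _ → ST-exists s (map location (phaseRequests s R t))
    ; threshold-mono        = λ s R _ _ → ST-mono
    ; threshold-nonNegative = λ s R → ST-nonNegative
    ; threshold≤len         = λ s R → ST≤len
    ; phaseCost             = λ s R {F = F} _ st (_ , st′ , _) → ST-phaseCost {F = F} st st′
    ; choice-covers         = λ ch → proj₂ (proj₁ ch)
    ; choice-exists         = ST-choice-exists
    }

  -- The terminal-MST rule

  MST-exists : ∀ a A → ∃ (IsMST (a ∷ A))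
  MST-exists a A =
    let F , spanning = spanningTree a A
        G , _ , minimum = minimumTree (spanningKind (a ∷ A)) {F} spanning
    in weight G , minimum

  MST-nonNegative : ∀ {A w} → IsMST A w → 0# ≤ w
  MST-nonNegative ((F , _ , wF≈w) , _) = ≤-trans (weight-nonNegative F) (≤-reflexive wF≈w)

  -- A spanning tree may not use points outside its terminal set, so an additional terminal can make
  -- the minimum smaller. In contrast to `ST-mono`, both inclusions are required; this failure of
  -- monotonicity is why the rule uses an envelope.
  MST-resp-⊆ : ∀ {A B v w} → A ⊆ B → B ⊆ A → IsMST A v → IsMST B w → v ≤ w
  MST-resp-⊆ {w = w} A⊆B B⊆A (_ , minimal) ((F , (u , B⊆ , ⊆B) , wF≈w) , _) =
    minimal w (F , (u , B⊆ ∘ A⊆B , B⊆A ∘ ⊆B) , wF≈w)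

  MST≤len : ∀ {a A w} y W → a ∷ A ⊆ y ∷ W → IsMST (a ∷ A) w → w ≤ len y W
  MST≤len y W A⊆ (_ , minimal) =
    let F , spanning , wF≤ = walk⇒spanningTree y W A⊆
    in ≤-trans (minimal (weight F) (F , spanning , ≈-refl)) wF≤

  IsEnvelope : Point → List Request → Time → Time → Carrier → Set _
  IsEnvelope s R α t = IsGreatest (λ m → ∃ λ u → α ≤ u × u ≤ t × IsMST (terminals s R u) m)

  events-mono : ∀ {R α t u} → u ≤ t → events R α u ⊆ events R α t
  events-mono u≤t (here eq) = here eq
  events-mono {R} {α} {t} {u} u≤t (there e∈) =
    let e∈R , α≤e , e≤u = ∈-filter⁻ (λ v → α ≤? v ×-dec v ≤? u) {xs = map arrival R} e∈
    in there (∈-filter⁺ (λ v → α ≤? v ×-dec v ≤? t) e∈R (α≤e , ≤-trans e≤u u≤t))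

  envelope-exists : ∀ s R {α t} → α ≤ t → ∃ (IsEnvelope s R α t)
  envelope-exists s R {α} {t} α≤t =
    let e , e∈ , maximal = greatest (λ u → proj₁ (mstAt u)) {xs = events R α t} (here refl)
        α≤e , e≤t = ∈-events⁻ {R} α≤t e∈
    in proj₁ (mstAt e) , (e , α≤e , e≤t , proj₂ (mstAt e)) , λ m (u , α≤u , u≤t , mstᵤ) →
      -- No request arrives between `e′` and `u`, so the terminals agree there and the maximum over
      -- events dominates the value at `u`.
      let e′ , e′∈ , arrived = latestEvent R α u
          e′≤u = proj₂ (∈-events⁻ {R} α≤u e′∈)
      in ≤-trans (MST-resp-⊆ (terminals-⊆ s R arrived) (terminals-mono s R e′≤u) mstᵤ (proj₂ (mstAt e′)))
                 (maximal (events-mono {R} u≤t e′∈))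
    where
    mstAt : ∀ u → ∃ (IsMST (terminals s R u))
    mstAt u = MST-exists s (map location (phaseRequests s R u))

  envelope-mono : ∀ s R {α t t′ w w′} → α ≤ t′ → terminals s R t ⊆ terminals s R t′ →
                  IsEnvelope s R α t w → IsEnvelope s R α t′ w′ → w ≤ w′
  envelope-mono s R {t′ = t′} {w} α≤t′ At⊆At′ ((u , α≤u , u≤t , mstᵤ) , _) (_ , maximal′) with total u t′
  ... | inj₁ u≤t′ = maximal′ w (u , α≤u , u≤t′ , mstᵤ)
  -- Here `t′ ≤ u ≤ t` while the terminals at `t` are among those at `t′`, so the terminal sets at
  -- `u` and `t′` coincide.
  ... | inj₂ t′≤u =
    let w″ , mst′ = MST-exists s (map location (phaseRequests s R t′))
    in ≤-trans (MST-resp-⊆ (At⊆At′ ∘ terminals-mono s R u≤t) (terminals-mono s R t′≤u) mstᵤ mst′)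
               (maximal′ w″ (t′ , α≤t′ , ≤-refl , mst′))

  envelope-nonNegative : ∀ s R {α t w} → IsEnvelope s R α t w → 0# ≤ w
  envelope-nonNegative s R ((_ , _ , _ , mst) , _) = MST-nonNegative mst

  -- A walk through the terminals at `t` also covers those at the earlier time where the envelope is
  -- attained. The length even bounds `w`; half of that is given away.
  ½envelope≤len : ∀ s R {α t w} y W → terminals s R t ⊆ y ∷ W → IsEnvelope s R α t w → ½ * w ≤ len y W
  ½envelope≤len s R {w = w} y W A⊆ env@((u , _ , u≤t , mst) , _) = begin
    ½ * w           ≤⟨ x≤x+y (½ * w) (*-nonNegative 0≤½ (envelope-nonNegative s R env)) ⟩
    ½ * w + ½ * w   ≈⟨ ½x+½x≈x w ⟩
    w               ≤⟨ MST≤len y W (A⊆ ∘ terminals-mono s R u≤t) mst ⟩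
    len y W         ∎

  MST-phaseCost : ∀ s R {α t w F} → α ≤ t → IsEnvelope s R α t w → IsMST (terminals s R t) (weight F) →
                  weight F + weight F + ½ * w ≤ (1# + 1# + 1# + 1# + 1#) * (½ * w)
  MST-phaseCost s R {t = t} {w} {F} α≤t (_ , maximal) mst = begin
    weight F + weight F + ½ * w
      ≤⟨ +-monoˡ-≤ (½ * w) (+-mono-≤ wF≤w wF≤w) ⟩
    w + w + ½ * w
      ≈⟨ +-congʳ (+-cong (½x+½x≈x w) (½x+½x≈x w)) ⟨
    ½ * w + ½ * w + (½ * w + ½ * w) + ½ * w
      ≈⟨ solve 1 (λ v → v :+ v :+ (v :+ v) :+ v := (con 1 :+ con 1 :+ con 1 :+ con 1 :+ con 1) :* v) ≈-refl (½ * w) ⟩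
    (1# + 1# + 1# + 1# + 1#) * (½ * w) ∎
    where
    wF≤w : weight F ≤ w
    wF≤w = maximal (weight F) (t , α≤t , ≤-refl , mst)

  MST-choice-exists : ∀ s {P p₀} → p₀ ∈ P →
                      ∃ λ F → ∃ λ p → ∃ λ (i : location p ∈ᵀ F) →
                      p ∈ P × root F ≡ s × PhaseRule.choice terminalMST P (s ∷ map location P) F p i
  MST-choice-exists s {P} {p₀} p₀∈P =
    let F₀ , spanning = spanningTree s (map location P)
        F , root≡ , okF , minimum =
          minimumTreeFrom (spanningKind (s ∷ map location P)) {F = F₀} (λ ok → proj₁ (proj₂ ok) (here refl)) spanning
    in F , p₀ , ∈-vertices⇒∈ᵀ F (proj₁ (proj₂ okF) (there (∈-map⁺ location p₀∈P))) , p₀∈P , root≡ , okF , minimum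

  terminalMST-lawful : Lawful terminalMST (1# + 1# + 1# + 1# + 1#)
  terminalMST-lawful = record
    { threshold-exists      = λ s R α≤t → let w , env = envelope-exists s R α≤t in ½ * w , w , env , ≈-refl
    ; threshold-mono        = λ s R {v = v} {v′} α≤t α≤t′ A⊆A′ (w , env , v≈) (w′ , env′ , v′≈) → begin
        v        ≈⟨ v≈ ⟩
        ½ * w    ≤⟨ *-monoʳ-≤ 0≤½ (envelope-mono s R α≤t′ A⊆A′ env env′) ⟩
        ½ * w′   ≈⟨ v′≈ ⟨
        v′       ∎
    ; threshold-nonNegative = λ s R (w , env , v≈) →
        ≤-trans (*-nonNegative 0≤½ (envelope-nonNegative s R env)) (≤-reflexive (≈-sym v≈))
    ; threshold≤len         = λ s R y W A⊆ (w , env , v≈) →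
        ≤-trans (≤-reflexive v≈) (½envelope≤len s R y W A⊆ env)
    ; phaseCost             = λ s R {v = v} {F} α≤t (w , env , v≈) (_ , mst) → begin
        weight F + weight F + v                   ≈⟨ +-congˡ v≈ ⟩
        weight F + weight F + ½ * w               ≤⟨ MST-phaseCost s R {F = F} α≤t env mst ⟩
        (1# + 1# + 1# + 1# + 1#) * (½ * w)        ≈⟨ *-congˡ v≈ ⟨
        (1# + 1# + 1# + 1# + 1#) * v              ∎
    ; choice-covers         = λ ch → proj₁ (proj₂ (proj₁ ch))
    ; choice-exists         = MST-choice-exists
    }

  -- Triggers and runs

  later : Time → List Request → List Request
  later t = filter (λ q → ¬? (arrival q ≤? t))

  IsGood : PhaseRule → Point → List Request → Time → Time → Set _
  IsGood rule s R α t = α ≤ t × ∃ λ v → PhaseRule.threshold rule (terminals s R) α t v × v ≤ t - α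

  module _ {rule : PhaseRule} {κ : Carrier} (lawful : Lawful rule κ) where
    open PhaseRule rule
    open Lawful lawful

    -- The threshold does not decrease in the course of a phase, so the test
    -- first succeeds with equality.
    trigger-threshold : ∀ s R {α t} → IsTrigger rule s R α t →
                        α ≤ t × ∃ λ v → threshold (terminals s R) α t v × v + α ≈ t
    trigger-threshold s R {α} {t} ((α≤t , v , th , v≤t-α) , minimal) =
      α≤t , v , th , antisym v+α≤t (minimal (v + α) (α≤v+α , v′ , th′ , x+z≤y⇒x≤y-z (+-monoˡ-≤ α v′≤v)))
      where
      v+α≤t : v + α ≤ t
      v+α≤t = x≤y-z⇒x+z≤y v≤t-α
      α≤v+α : α ≤ v + α
      α≤v+α = x≤y+x α (threshold-nonNegative s R th)
      v′ = proj₁ (threshold-exists s R α≤v+α)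
      th′ : threshold (terminals s R) α (v + α) v′
      th′ = proj₂ (threshold-exists s R α≤v+α)
      v′≤v : v′ ≤ v
      v′≤v = threshold-mono s R α≤v+α α≤t (terminals-mono s R v+α≤t) th′ th

    threshold-halfway : ∀ s R {α t v v′} → IsTrigger rule s R α t → v + α ≈ t → 0# ≤ v →
                        threshold (terminals s R) α (½ * v + α) v′ → ½ * v ≤ v′
    threshold-halfway s R {α} {t} {v} {v′} (_ , minimal) v+α≈t 0≤v th with total (½ * v) v′
    ... | inj₁ ½v≤v′ = ½v≤v′
    -- The test then succeeds at the midpoint already, so minimality puts `t` at or before it. This
    -- forces `½ * v` to be at most `0#`, and thresholds are nonnegative.
    ... | inj₂ v′≤½v = ≤-trans (≤-from t≤β identity) (threshold-nonNegative s R th)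
      where
      t≤β : t ≤ ½ * v + α
      t≤β = minimal (½ * v + α) (x≤y+x α (*-nonNegative 0≤½ 0≤v) , v′ , th ,
        x+z≤y⇒x≤y-z (+-monoˡ-≤ α v′≤½v))
      identity : ½ * v + (½ * v + α) ≈ 0# + t
      identity = ≈-trans (≈-sym (+-assoc (½ * v) (½ * v) α))
        (≈-trans (+-congʳ (½x+½x≈x v)) (≈-trans v+α≈t (≈-sym (+-identityˡ t))))

    -- The rule gives the threshold as a relation; fixing one of its values makes the trigger test
    -- decidable.
    θ : Point → List Request → Time → Time → Carrier
    θ s R α t with α ≤? t
    ... | yes α≤t = proj₁ (threshold-exists s R α≤t)
    ... | no _    = 0#

    θ-threshold : ∀ s R {α t} → α ≤ t → threshold (terminals s R) α t (θ s R α t)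
    θ-threshold s R {α} {t} α≤t with α ≤? t
    ... | yes α≤t′ = proj₂ (threshold-exists s R α≤t′)
    ... | no α≰t   = contradiction α≤t α≰t

    good? : ∀ s R α t → Dec (IsGood rule s R α t)
    good? s R α t with α ≤? t
    ... | no α≰t = no (α≰t ∘ proj₁)
    ... | yes α≤t with θ s R α t ≤? t - α
    ...   | yes θ≤ = yes (α≤t , θ s R α t , θ-threshold s R α≤t , θ≤)
    -- By monotonicity along `id`, any two values of the threshold at `t` bound each other, so a
    -- failure with the fixed value is a failure with every `v`.
    ...   | no θ≰  = no λ (_ , v , th , v≤) →
      θ≰ (≤-trans (threshold-mono s R α≤t α≤t id (θ-threshold s R α≤t) th) v≤)

    -- Between two arrivals the threshold is constant, so the test can first
    -- succeed only at an arrival time e or at the time θ(e) + α.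
    candidate : Point → List Request → Time → Time → Time
    candidate s R α e with total (θ s R α e + α) e
    ... | inj₁ _ = e
    ... | inj₂ _ = θ s R α e + α

    candidate-upper : ∀ s R α e → e ≤ candidate s R α e × θ s R α e + α ≤ candidate s R α e
    candidate-upper s R α e with total (θ s R α e + α) e
    ... | inj₁ θ≤e = ≤-refl , θ≤e
    ... | inj₂ e≤θ = e≤θ , ≤-refl

    candidate-least : ∀ s R α e {t} → e ≤ t → θ s R α e + α ≤ t → candidate s R α e ≤ t
    candidate-least s R α e e≤t θ≤t with total (θ s R α e + α) e
    ... | inj₁ _ = e≤t
    ... | inj₂ _ = θ≤t

    -- No request arrives after `e` up to the candidate, so the threshold there is at most the one
    -- at `e`, for which the candidate leaves enough time.
    candidate-good : ∀ s R {α e t} → α ≤ e → candidate s R α e ≤ t →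
                     (∀ {q} → q ∈ R → arrival q ≤ t → arrival q ≤ e) →
                     IsGood rule s R α (candidate s R α e)
    candidate-good s R {α} {e} {t} α≤e c≤t arrived =
      α≤c , θ s R α _ , θ-threshold s R α≤c ,
      x+z≤y⇒x≤y-z (≤-trans (+-monoˡ-≤ α θc≤θe) (proj₂ (candidate-upper s R α e)))
      where
      α≤c : α ≤ candidate s R α e
      α≤c = ≤-trans α≤e (proj₁ (candidate-upper s R α e))
      θc≤θe : θ s R α (candidate s R α e) ≤ θ s R α e
      θc≤θe = threshold-mono s R α≤c α≤e
        (terminals-⊆ s R (λ q∈R q≤c → arrived q∈R (≤-trans q≤c c≤t)))
        (θ-threshold s R α≤c) (θ-threshold s R α≤e)

    -- Every time at which the test succeeds has a successful candidate at or before it, so the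
    -- least successful candidate, taken from a finite list, is the trigger.
    trigger-exists : ∀ s R α → ∃ (IsTrigger rule s R α)
    trigger-exists s R α =
      let t , t∈ , minimal = least id (proj₁ (proj₂ (proj₂ someGood)))
      in t , proj₂ (∈-filter⁻ (good? s R α) {xs = candidates} t∈) , λ t′ good →
         let c , c∈ , c≤t′ = below t′ good in ≤-trans (minimal c∈) c≤t′
      where
      candidates : List Time
      candidates = map (candidate s R α) (α ∷ map arrival R)

      goodCandidates : List Time
      goodCandidates = filter (good? s R α) candidates

      events⊆ : ∀ {t e} → e ∈ events R α t → e ∈ α ∷ map arrival R
      events⊆ (here eq) = here eq
      events⊆ {t} (there e∈) = there (proj₁ (∈-filter⁻ (λ u → α ≤? u ×-dec u ≤? t) {xs = map arrival R} e∈))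

      below : ∀ t → IsGood rule s R α t → ∃ λ c → c ∈ goodCandidates × c ≤ t
      below t (α≤t , v , th , v≤t-α) =
        let e , e∈ , arrived = latestEvent R α t
            α≤e , e≤t = ∈-events⁻ {R} α≤t e∈
            θe≤v = threshold-mono s R α≤e α≤t (terminals-mono s R e≤t) (θ-threshold s R α≤e) th
            c≤t = candidate-least s R α e e≤t (x≤y-z⇒x+z≤y (≤-trans θe≤v v≤t-α))
        in candidate s R α e ,
           ∈-filter⁺ (good? s R α) (∈-map⁺ (candidate s R α) (events⊆ e∈)) (candidate-good s R α≤e c≤t arrived) ,
           c≤t

      someGood : ∃ λ t → ∃ λ c → c ∈ goodCandidates × c ≤ t
      someGood =
        -- After the last arrival the terminals no longer change, so the test succeeds once enough
        -- time has passed.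
        let e , e∈ , latest = greatest id {xs = α ∷ map arrival R} (here refl)
            t = candidate s R α e
        in t , below t (candidate-good s R (latest (here refl)) ≤-refl
             (λ q∈R _ → latest (there (∈-map⁺ arrival q∈R))))

    -- Existence of runs.

    phaseStart-exists : ∀ s R {q} → q ∈ awayFrom s R → ∃ (IsPhaseStart s R)
    phaseStart-exists s R q∈ =
      let p , p∈ , earliest = least arrival q∈
      in arrival p , (p , p∈ , ≈-refl) , λ u (r , r∈ , r≈u) → ≤-trans (earliest r∈) (≤-reflexive r≈u)

    phase-exists : ∀ {s R α t q} → IsPhaseStart s R α → IsTrigger rule s R α t → q ∈ phaseRequests s R t →
                   (∀ s′ → ∃ (PhaseRun rule s′ (later t R))) → ∃ (PhaseRun rule s R)
    phase-exists {s} {R} {α} {t} start trigger q∈P rest = build (choice-exists s q∈P)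
      where
      build : (∃ λ F → ∃ λ p → ∃ λ (i : location p ∈ᵀ F) → p ∈ phaseRequests s R t × root F ≡ s ×
                choice (phaseRequests s R t) (terminals s R t) F p i) → ∃ (PhaseRun rule s R)
      build (F , p , i , p∈P , root≡ , ok) = _ , phase start trigger p∈P root≡ i ok (proj₂ (rest (location p)))

    later-shorter : ∀ s R {t q} → q ∈ phaseRequests s R t → length (later t R) ℕ.< length R
    later-shorter s R {t} q∈P with ∈-phaseRequests⁻ s R t q∈P
    ... | q∈R , _ , q≤t = filter-notAll (λ q → ¬? (arrival q ≤? t)) R (lose q∈R (λ q≰t → q≰t q≤t))

    -- Each phase removes at least the request that started it, so a bound `n` on the number of
    -- remaining requests serves as termination measure.
    run-exists : ∀ n s R → length R ℕ.≤ n → ∃ (PhaseRun rule s R)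
    firstPhase : ∀ n s R {α t} → length R ℕ.≤ n → IsPhaseStart s R α → IsTrigger rule s R α t →
                 ∃ (PhaseRun rule s R)
    run-exists n s R R≤n with awayFrom s R in eq
    ... | []    = [] , idle eq
    ... | q ∷ _ = firstPhase n s R R≤n
      (proj₂ (phaseStart-exists s R (subst (q ∈_) (≡.sym eq) (here refl)))) (proj₂ (trigger-exists s R _))
    firstPhase n s R {α} {t} R≤n start@((q , q∈away , q≈α) , _) trigger@((α≤t , _) , _) =
      phase-exists start trigger q∈P (rest n (ℕ.≤-trans (later-shorter s R q∈P) R≤n))
      where
      q∈P : q ∈ phaseRequests s R t
      q∈P = ∈-filter⁺ (λ q → arrival q ≤? t) q∈away (≤-trans (≤-reflexive q≈α) α≤t)
      rest : ∀ n → length (later t R) ℕ.< n → ∀ s′ → ∃ (PhaseRun rule s′ (later t R))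
      rest (ℕ.suc n) (ℕ.s≤s R′≤n) s′ = run-exists n s′ (later t R) R′≤n

  -- Offline schedules

  maxDelay-nonNegative : ∀ t B → 0# ≤ maxDelay t B
  maxDelay-nonNegative t B = Extrema.⊥≤max 0# (map (λ q → t - arrival q) B)

  delay≤maxDelay : ∀ t {B q} → q ∈ B → t - arrival q ≤ maxDelay t B
  delay≤maxDelay t {B} q∈B =
    All.lookup (Extrema.xs≤max 0# (map (λ q → t - arrival q) B)) (∈-map⁺ (λ q → t - arrival q) q∈B)

  maxDelay-sel : ∀ t B → maxDelay t B ≡ 0# ⊎ ∃ λ q → q ∈ B × maxDelay t B ≡ t - arrival q
  maxDelay-sel t B with Extrema.argmax-sel id 0# (map (λ q → t - arrival q) B)
  ... | inj₁ eq = inj₁ eq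
  ... | inj₂ m∈ = inj₂ (∈-map⁻ (λ q → t - arrival q) m∈)

  ∈-receive⁻ : ∀ t σ {q} → q ∈ pending (receive t σ) →
               q ∈ pending σ ⊎ (q ∈ upcoming σ × arrival q ≤ t × location q ≢ position σ)
  ∈-receive⁻ t σ q∈ with ∈-++⁻ (pending σ) q∈
  ... | inj₁ q∈σ = inj₁ q∈σ
  ... | inj₂ q∈new with ∈-filter⁻ (λ q → ¬? (location q ≟ position σ))
                         {xs = filter (λ q → arrival q ≤? t) (upcoming σ)} q∈new
  ...   | q∈arrived , q≢ with ∈-filter⁻ (λ q → arrival q ≤? t) {xs = upcoming σ} q∈arrived
  ...     | q∈up , q≤t = inj₂ (q∈up , q≤t , q≢)

  ∈-receive⁺ : ∀ t σ {q} → q ∈ upcoming σ → arrival q ≤ t → location q ≢ position σ →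
               q ∈ pending (receive t σ)
  ∈-receive⁺ t σ q∈up q≤t q≢ = ∈-++⁺ʳ (pending σ)
    (∈-filter⁺ (λ q → ¬? (location q ≟ position σ)) (∈-filter⁺ (λ q → arrival q ≤? t) q∈up q≤t) q≢)

  ∈-receive-mono : ∀ {t t′} σ {q} → t ≤ t′ → q ∈ pending (receive t σ) → q ∈ pending (receive t′ σ)
  ∈-receive-mono {t} {t′} σ t≤t′ q∈ with ∈-receive⁻ t σ q∈
  ... | inj₁ q∈σ              = ∈-++⁺ˡ q∈σ
  ... | inj₂ (q∈up , q≤t , q≢) = ∈-receive⁺ t′ σ q∈up (≤-trans q≤t t≤t′) q≢

  perform-spent : ∀ t σ P → spent σ + len (position σ) P ≤ spent (perform t σ P)
  perform-spent t σ P = +-monoʳ-≤ (spent σ) (x≤x+y _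
    (maxDelay-nonNegative t (filter (λ q → location q ∈? position σ ∷ P) (pending σ))))

  perform-keeps : ∀ t σ P {q} → q ∈ pending σ → q ∈ pending (perform t σ P) ⊎
                  (location q ∈ position σ ∷ P ×
                   spent σ + (len (position σ) P + (t - arrival q)) ≤ spent (perform t σ P))
  perform-keeps t σ P {q} q∈σ with location q ∈? position σ ∷ P
  ... | yes visited = inj₂ (visited , +-monoʳ-≤ (spent σ) (+-monoʳ-≤ (len (position σ) P)
    (delay≤maxDelay t (∈-filter⁺ (λ q → location q ∈? position σ ∷ P) q∈σ visited))))
  ... | no missed = inj₁ (∈-filter⁺ (λ q → ¬? (location q ∈? position σ ∷ P)) q∈σ missed)

  position-performs : ∀ t σ Ps → position (foldl (perform t) σ Ps) ≡ endpoint (position σ) (concat Ps)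
  position-performs t σ []       = refl
  position-performs t σ (P ∷ Ps) =
    ≡.trans (position-performs t (perform t σ P) Ps) (≡.sym (endpoint-++ (position σ) P (concat Ps)))

  upcoming-performs : ∀ t σ Ps → upcoming (foldl (perform t) σ Ps) ≡ upcoming σ
  upcoming-performs t σ []       = refl
  upcoming-performs t σ (P ∷ Ps) = upcoming-performs t (perform t σ P) Ps

  performs-spent : ∀ t σ Ps → spent σ + len (position σ) (concat Ps) ≤ spent (foldl (perform t) σ Ps)
  performs-spent t σ []       = ≤-reflexive (+-identityʳ (spent σ))
  performs-spent t σ (P ∷ Ps) = begin
    spent σ + len v (P ++ concat Ps)
      ≈⟨ +-congˡ (len-++ v P (concat Ps)) ⟩
    spent σ + (len v P + len (endpoint v P) (concat Ps))
      ≈⟨ +-assoc _ _ _ ⟨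
    spent σ + len v P + len (endpoint v P) (concat Ps)
      ≤⟨ +-monoˡ-≤ _ (perform-spent t σ P) ⟩
    spent (perform t σ P) + len (endpoint v P) (concat Ps)
      ≤⟨ performs-spent t (perform t σ P) Ps ⟩
    spent (foldl (perform t) σ (P ∷ Ps)) ∎
    where v = position σ

  -- A service event pays its longest delay on top of the length of its walk, so an action that
  -- serves `q` covers its whole length and the delay of `q` together.
  performs-keeps : ∀ t σ Ps {q} → q ∈ pending σ → q ∈ pending (foldl (perform t) σ Ps) ⊎
                   (location q ∈ position σ ∷ concat Ps ×
                    spent σ + (len (position σ) (concat Ps) + (t - arrival q)) ≤ spent (foldl (perform t) σ Ps))
  performs-keeps t σ []       q∈ = inj₁ q∈
  performs-keeps t σ (P ∷ Ps) {q} q∈ with perform-keeps t σ P q∈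
  ... | inj₂ (visited , paid) = inj₂ (∈-++⁺ˡ visited , (begin
    spent σ + (len v (P ++ concat Ps) + δ)
      ≈⟨ +-congˡ (+-congʳ (len-++ v P (concat Ps))) ⟩
    spent σ + (len v P + l + δ)
      ≈⟨ solve 4 (λ s p l δ → s :+ (p :+ l :+ δ) := s :+ (p :+ δ) :+ l) ≈-refl (spent σ) (len v P) l δ ⟩
    spent σ + (len v P + δ) + l
      ≤⟨ +-monoˡ-≤ l paid ⟩
    spent (perform t σ P) + l
      ≤⟨ performs-spent t (perform t σ P) Ps ⟩
    spent (foldl (perform t) σ (P ∷ Ps)) ∎))
    where
    v = position σ
    l = len (endpoint v P) (concat Ps)
    δ = t - arrival q
  ... | inj₁ q∈′ with performs-keeps t (perform t σ P) Ps q∈′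
  ...   | inj₁ kept = inj₁ kept
  ...   | inj₂ (visited , paid) = inj₂ (∈-concat-tail visited , (begin
    spent σ + (len v (P ++ concat Ps) + δ)
      ≈⟨ +-congˡ (+-congʳ (len-++ v P (concat Ps))) ⟩
    spent σ + (len v P + l + δ)
      ≈⟨ solve 4 (λ s p l δ → s :+ (p :+ l :+ δ) := s :+ p :+ (l :+ δ)) ≈-refl (spent σ) (len v P) l δ ⟩
    spent σ + len v P + (l + δ)
      ≤⟨ +-monoˡ-≤ (l + δ) (perform-spent t σ P) ⟩
    spent (perform t σ P) + (l + δ)
      ≤⟨ paid ⟩
    spent (foldl (perform t) σ (P ∷ Ps)) ∎))
    where
    v = position σ
    l = len (endpoint v P) (concat Ps)
    δ = t - arrival q
    ∈-concat-tail : ∀ {x} → x ∈ endpoint v P ∷ concat Ps → x ∈ v ∷ P ++ concat Ps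
    ∈-concat-tail (here refl) = ∈-++⁺ˡ (endpoint-∈ v P)
    ∈-concat-tail (there x∈)  = ∈-++⁺ʳ (v ∷ P) x∈

  route : Schedule → Walk
  route []             = []
  route ((t ▹ Ps) ∷ S) = concat Ps ++ route S

  run : State → Schedule → State
  run = foldl act

  position-run : ∀ σ S → position (run σ S) ≡ endpoint (position σ) (route S)
  position-run σ []             = refl
  position-run σ ((t ▹ Ps) ∷ S) = ≡.trans (position-run (act σ (t ▹ Ps)) S)
    (≡.trans (cong (λ v → endpoint v (route S)) (position-performs t (receive t σ) Ps))
             (≡.sym (endpoint-++ (position σ) (concat Ps) (route S))))

  len-route : ∀ σ t Ps S → len (position σ) (route ((t ▹ Ps) ∷ S)) ≈
              len (position σ) (concat Ps) + len (position (act σ (t ▹ Ps))) (route S)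
  len-route σ t Ps S = ≈-trans (len-++ (position σ) (concat Ps) (route S))
    (+-congˡ (≈-reflexive (cong (λ v → len v (route S)) (≡.sym (position-performs t (receive t σ) Ps)))))

  run-spent : ∀ σ S → spent σ + len (position σ) (route S) ≤ spent (run σ S)
  run-spent σ []             = ≤-reflexive (+-identityʳ (spent σ))
  run-spent σ ((t ▹ Ps) ∷ S) = begin
    spent σ + len (position σ) (route ((t ▹ Ps) ∷ S))
      ≈⟨ +-congˡ (len-route σ t Ps S) ⟩
    spent σ + (len (position σ) (concat Ps) + len (position σ₁) (route S))
      ≈⟨ +-assoc _ _ _ ⟨
    spent σ + len (position σ) (concat Ps) + len (position σ₁) (route S)
      ≤⟨ +-monoˡ-≤ _ (performs-spent t (receive t σ) Ps) ⟩
    spent σ₁ + len (position σ₁) (route S)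
      ≤⟨ run-spent σ₁ S ⟩
    spent (run σ ((t ▹ Ps) ∷ S)) ∎
    where σ₁ = act σ (t ▹ Ps)

  -- The state takes in arrivals only when an action is performed, so what is outstanding at time
  -- `T` is read off `receive T σ`. All actions of `S` come at `T` or later, so whichever serves the
  -- request pays at least the delay accumulated at `T`.
  run-keeps : ∀ T σ S {q} → All (λ α → T ≤ time α) S → q ∈ pending (receive T σ) →
              q ∈ pending (receive T (run σ S)) ⊎
              spent σ + (len (position σ) (route S) + (T - arrival q)) ≤ spent (run σ S)
  run-keeps T σ []             _            q∈ = inj₁ q∈
  run-keeps T σ ((t ▹ Ps) ∷ S) {q} (T≤t ∷ T≤S) q∈
    with performs-keeps t (receive t σ) Ps (∈-receive-mono σ T≤t q∈)
  ... | inj₂ (_ , paid) = inj₂ (begin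
    spent σ + (len (position σ) (route ((t ▹ Ps) ∷ S)) + (T - arrival q))
      ≤⟨ +-monoʳ-≤ (spent σ) (+-mono-≤ (≤-reflexive (len-route σ t Ps S)) (+-monoˡ-≤ (- arrival q) T≤t)) ⟩
    spent σ + (l + l′ + (t - arrival q))
      ≈⟨ solve 4 (λ s l l′ δ → s :+ (l :+ l′ :+ δ) := s :+ (l :+ δ) :+ l′) ≈-refl (spent σ) l l′ (t - arrival q) ⟩
    spent σ + (l + (t - arrival q)) + l′
      ≤⟨ +-monoˡ-≤ l′ paid ⟩
    spent σ₁ + l′
      ≤⟨ run-spent σ₁ S ⟩
    spent (run σ₁ S) ∎)
    where
    σ₁ = act σ (t ▹ Ps)
    l  = len (position σ) (concat Ps)
    l′ = len (position σ₁) (route S)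
  ... | inj₁ q∈σ₁ with run-keeps T (act σ (t ▹ Ps)) S T≤S (∈-++⁺ˡ q∈σ₁)
  ...   | inj₁ kept = inj₁ kept
  ...   | inj₂ paid = inj₂ (begin
    spent σ + (len (position σ) (route ((t ▹ Ps) ∷ S)) + (T - arrival q))
      ≈⟨ +-congˡ (+-congʳ (len-route σ t Ps S)) ⟩
    spent σ + (l + l′ + (T - arrival q))
      ≈⟨ solve 4 (λ s l l′ δ → s :+ (l :+ l′ :+ δ) := s :+ l :+ (l′ :+ δ)) ≈-refl (spent σ) l l′ (T - arrival q) ⟩
    spent σ + l + (l′ + (T - arrival q))
      ≤⟨ +-monoˡ-≤ _ (performs-spent t (receive t σ) Ps) ⟩
    spent σ₁ + (l′ + (T - arrival q))
      ≤⟨ paid ⟩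
    spent (run σ₁ S) ∎)
    where
    σ₁ = act σ (t ▹ Ps)
    l  = len (position σ) (concat Ps)
    l′ = len (position σ₁) (route S)

  run-visits : ∀ T σ S {q} → All (λ α → time α ≤ T) S → q ∈ pending σ ⊎ q ∈ upcoming σ → arrival q ≤ T →
               q ∈ pending (receive T (run σ S)) ⊎ location q ∈ position σ ∷ route S
  run-visits T σ [] _ (inj₁ q∈) q≤T = inj₁ (∈-++⁺ˡ q∈)
  run-visits T σ [] {q} _ (inj₂ q∈) q≤T with location q ≟ position σ
  ... | yes q≡ = inj₂ (here q≡)
  ... | no q≢  = inj₁ (∈-receive⁺ T σ q∈ q≤T q≢)
  run-visits T σ ((t ▹ Ps) ∷ S) {q} (t≤T ∷ S≤T) q∈ q≤T = fromReceived (received q∈)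
    where
    σ₁ = act σ (t ▹ Ps)

    received : q ∈ pending σ ⊎ q ∈ upcoming σ →
               q ∈ pending (receive t σ) ⊎ q ∈ upcoming (receive t σ) ⊎ location q ≡ position σ
    received (inj₁ q∈) = inj₁ (∈-++⁺ˡ q∈)
    received (inj₂ q∈) with arrival q ≤? t | location q ≟ position σ
    ... | no q≰t  | _      = inj₂ (inj₁ (∈-filter⁺ (λ q → ¬? (arrival q ≤? t)) q∈ q≰t))
    ... | yes q≤t | yes q≡ = inj₂ (inj₂ q≡)
    ... | yes q≤t | no q≢  = inj₁ (∈-receive⁺ t σ q∈ q≤t q≢)

    widen : ∀ {x} → x ∈ position σ₁ ∷ route S → x ∈ position σ ∷ concat Ps ++ route S
    widen (here refl) = ∈-++⁺ˡ (subst (_∈ position σ ∷ concat Ps)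
      (≡.sym (position-performs t (receive t σ) Ps)) (endpoint-∈ (position σ) (concat Ps)))
    widen (there x∈)  = ∈-++⁺ʳ (position σ ∷ concat Ps) x∈

    fromRest : q ∈ pending σ₁ ⊎ q ∈ upcoming σ₁ →
               q ∈ pending (receive T (run σ₁ S)) ⊎ location q ∈ position σ ∷ concat Ps ++ route S
    fromRest q∈ with run-visits T σ₁ S S≤T q∈ q≤T
    ... | inj₁ outstanding = inj₁ outstanding
    ... | inj₂ visited     = inj₂ (widen visited)

    fromReceived : q ∈ pending (receive t σ) ⊎ q ∈ upcoming (receive t σ) ⊎ location q ≡ position σ →
                   q ∈ pending (receive T (run σ₁ S)) ⊎ location q ∈ position σ ∷ concat Ps ++ route S
    fromReceived (inj₂ (inj₂ q≡)) = inj₂ (here q≡)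
    fromReceived (inj₂ (inj₁ q∈)) = fromRest (inj₂ (subst (q ∈_) (≡.sym (upcoming-performs t (receive t σ) Ps)) q∈))
    fromReceived (inj₁ q∈) with performs-keeps t (receive t σ) Ps q∈
    ... | inj₁ kept          = fromRest (inj₁ kept)
    ... | inj₂ (visited , _) = inj₂ (∈-++⁺ˡ visited)

  run-upcoming : ∀ T σ S {q} → All (λ α → time α ≤ T) S → q ∈ upcoming σ → ¬ arrival q ≤ T →
                 q ∈ upcoming (run σ S)
  run-upcoming T σ []             _           q∈ q≰T = q∈
  run-upcoming T σ ((t ▹ Ps) ∷ S) {q} (t≤T ∷ S≤T) q∈ q≰T = run-upcoming T (act σ (t ▹ Ps)) S S≤T
    (subst (q ∈_) (≡.sym (upcoming-performs t (receive t σ) Ps))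
      (∈-filter⁺ (λ q → ¬? (arrival q ≤? t)) q∈ (λ q≤t → q≰T (≤-trans q≤t t≤T)))) q≰T

  -- Offline cost together with accumulated delay.

  -- Besides the cost so far, count the longest delay that has already been
  -- accumulated by a request still pending at time T.
  waiting : State → Time → Carrier
  waiting σ T = maxDelay T (pending (receive T σ))

  committed : State → Time → Carrier
  committed σ T = spent σ + waiting σ T

  -- Follow a request with the longest delay at `T`. If `S` serves it, that delay is paid on top of
  -- the route, and `δ` is supplied by what is pending at the end. If it survives, its own delay has
  -- grown by at least `δ`.
  committed-run : ∀ σ S {T T′ δ} → All (λ α → T ≤ time α) S → δ + T ≤ T′ → 0# ≤ δ → δ ≤ waiting (run σ S) T′ →
                  committed σ T + (len (position σ) (route S) + δ) ≤ committed (run σ S) T′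
  committed-run σ S {T} {T′} {δ} T≤S δ+T≤T′ 0≤δ δ≤w′ with maxDelay-sel T (pending (receive T σ))
  ... | inj₁ w≡0 = begin
    spent σ + waiting σ T + (l + δ)
      ≡⟨ cong (λ w → spent σ + w + (l + δ)) w≡0 ⟩
    spent σ + 0# + (l + δ)
      ≈⟨ solve 3 (λ s l δ → s :+ con 0 :+ (l :+ δ) := s :+ l :+ δ) ≈-refl (spent σ) l δ ⟩
    spent σ + l + δ
      ≤⟨ +-mono-≤ (run-spent σ S) δ≤w′ ⟩
    spent (run σ S) + waiting (run σ S) T′ ∎
    where l = len (position σ) (route S)
  ... | inj₂ (q , q∈ , w≡) with run-keeps T σ S T≤S q∈
  ...   | inj₂ paid = begin
    spent σ + waiting σ T + (l + δ)
      ≡⟨ cong (λ w → spent σ + w + (l + δ)) w≡ ⟩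
    spent σ + (T - arrival q) + (l + δ)
      ≈⟨ solve 4 (λ s w l δ → s :+ w :+ (l :+ δ) := s :+ (l :+ w) :+ δ) ≈-refl (spent σ) (T - arrival q) l δ ⟩
    spent σ + (l + (T - arrival q)) + δ
      ≤⟨ +-mono-≤ paid δ≤w′ ⟩
    spent (run σ S) + waiting (run σ S) T′ ∎
    where l = len (position σ) (route S)
  ...   | inj₁ kept = begin
    spent σ + waiting σ T + (l + δ)
      ≡⟨ cong (λ w → spent σ + w + (l + δ)) w≡ ⟩
    spent σ + (T - arrival q) + (l + δ)
      ≈⟨ solve 4 (λ s w l δ → s :+ w :+ (l :+ δ) := s :+ l :+ (δ :+ w)) ≈-refl (spent σ) (T - arrival q) l δ ⟩
    spent σ + l + (δ + (T - arrival q))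
      ≤⟨ +-mono-≤ (run-spent σ S) (≤-trans stillWaiting (delay≤maxDelay T′ (∈-receive-mono (run σ S) T≤T′ kept))) ⟩
    spent (run σ S) + waiting (run σ S) T′ ∎
    where
    l = len (position σ) (route S)
    T≤T′ : T ≤ T′
    T≤T′ = ≤-trans (x≤y+x T 0≤δ) δ+T≤T′
    stillWaiting : δ + (T - arrival q) ≤ T′ - arrival q
    stillWaiting = x+z≤y⇒x≤y-z (≤-trans (≤-reflexive
      (≈-trans (+-assoc δ _ _) (+-congˡ (x-y+y≈x T (arrival q))))) δ+T≤T′)

  committed-mono : ∀ σ S {T T′} → All (λ α → T ≤ time α) S → T ≤ T′ →
                   committed σ T + len (position σ) (route S) ≤ committed (run σ S) T′
  committed-mono σ S {T} {T′} T≤S T≤T′ = ≤-trans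
    (≤-reflexive (+-congˡ (≈-sym (+-identityʳ _))))
    (committed-run σ S T≤S (≤-trans (≤-reflexive (+-identityˡ T)) T≤T′) ≤-refl
      (maxDelay-nonNegative T′ (pending (receive T′ (run σ S)))))

  committed≤final : ∀ σ S {T} → All (λ α → T ≤ time α) S → pending (run σ S) ≡ [] →
                    All (λ q → location q ≡ position (run σ S)) (upcoming (run σ S)) →
                    committed σ T ≤ spent (run σ S)
  committed≤final σ S {T} T≤S noPending upcomingHere = begin
    committed σ T                                  ≤⟨ x≤x+y _ (len-nonNegative (position σ) (route S)) ⟩
    committed σ T + len (position σ) (route S)     ≤⟨ committed-mono σ S T≤S ≤-refl ⟩
    spent (run σ S) + waiting (run σ S) T          ≤⟨ +-monoʳ-≤ _ waiting≤0 ⟩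
    spent (run σ S) + 0#                           ≈⟨ +-identityʳ _ ⟩
    spent (run σ S)                                ∎
    where
    waiting≤0 : waiting (run σ S) T ≤ 0#
    waiting≤0 with maxDelay-sel T (pending (receive T (run σ S)))
    ... | inj₁ w≡0 = subst (_≤ 0#) (≡.sym w≡0) ≤-refl
    ... | inj₂ (q , q∈ , _) with ∈-receive⁻ T (run σ S) q∈
    ...   | inj₁ q∈σ with () ← subst (q ∈_) noPending q∈σ
    -- A request that comes after the last action lies at the final position, so `receive` would
    -- have discarded it.
    ...   | inj₂ (q∈up , _ , q≢) = contradiction (All.lookup upcomingHere q∈up) q≢

  -- An action at exactly `T` may fall on either side, both bounds being weak.
  splitAt : ∀ T S → AllPairs (λ α β → time α ≤ time β) S →
            ∃ λ S₁ → ∃ λ S₂ → S ≡ S₁ ++ S₂ × All (λ α → time α ≤ T) S₁ × All (λ α → T ≤ time α) S₂ ×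
            AllPairs (λ α β → time α ≤ time β) S₂
  splitAt T [] [] = [] , [] , refl , [] , [] , []
  splitAt T (α ∷ S) (α≤S ∷ sorted) with total (time α) T
  ... | inj₂ T≤α = [] , α ∷ S , refl , [] , T≤α ∷ All.map (≤-trans T≤α) α≤S , α≤S ∷ sorted
  ... | inj₁ α≤T with splitAt T S sorted
  ...   | S₁ , S₂ , refl , S₁≤T , T≤S₂ , sorted₂ = α ∷ S₁ , S₂ , refl , α≤T ∷ S₁≤T , T≤S₂ , sorted₂

  -- One phase against the offline schedule.

  Outstanding : Point → State → Time → Set _
  Outstanding x σ T = ∃ λ q → q ∈ pending (receive T σ) × location q ≡ x × arrival q ≤ T

  module _ {rule : PhaseRule} {κ : Carrier} (lawful : Lawful rule κ) where
    open PhaseRule rule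
    open Lawful lawful

    -- Here `y` and `W` describe the offline walk of the preceding phase, `σ` is the offline state
    -- after it, and `S` holds the offline actions of the current phase. If a request that arrived
    -- by `β` is pending at `t`, then `committed` grows by `½ * v` on its own. Otherwise `W`
    -- followed by the route of `S` covers the terminals at `β`; the length of `W` appears on the
    -- right because `committed σ T` already contains it.
    phase-bound : ∀ {s R α t v T y W} σ S → IsTrigger rule s R α t → α ≤ t → v + α ≈ t →
                  threshold (terminals s R) α t v →
                  (∀ {q} → q ∈ R → q ∈ upcoming σ) → T ≤ α →
                  position σ ≡ endpoint y W → s ∈ y ∷ W ⊎ Outstanding s σ T →
                  All (λ α → T ≤ time α) S → All (λ α → time α ≤ t) S →
                  ½ * v + committed σ T ≤ len y W + committed (run σ S) t
    phase-bound {s} {R} {α} {t} {v} {T} {y} {W} σ S trigger α≤t v+α≈t th R⊆ T≤α pos≡ s∈ T≤S S≤t =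
      bound (any? (λ q → arrival q ≤? β) (pending (receive t (run σ S))))
      where
      β = ½ * v + α
      l = len (position σ) (route S)

      0≤½v : 0# ≤ ½ * v
      0≤½v = *-nonNegative 0≤½ (threshold-nonNegative s R th)

      ½v+β≈t : ½ * v + β ≈ t
      ½v+β≈t = ≈-trans (≈-sym (+-assoc _ _ _)) (≈-trans (+-congʳ (½x+½x≈x v)) v+α≈t)

      β≤t : β ≤ t
      β≤t = ≤-trans (x≤y+x β 0≤½v) (≤-reflexive ½v+β≈t)

      α≤β : α ≤ β
      α≤β = x≤y+x α 0≤½v

      bound : Dec _ → ½ * v + committed σ T ≤ len y W + committed (run σ S) t
      bound (yes late) = begin
        ½ * v + committed σ T
          ≤⟨ x≤x+y _ (len-nonNegative (position σ) (route S)) ⟩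
        ½ * v + committed σ T + l
          ≈⟨ solve 3 (λ h c l → h :+ c :+ l := c :+ (l :+ h)) ≈-refl (½ * v) (committed σ T) l ⟩
        committed σ T + (l + ½ * v)
          ≤⟨ committed-run σ S T≤S (≤-trans (+-monoʳ-≤ (½ * v) T≤α) β≤t) 0≤½v ½v≤waiting ⟩
        committed (run σ S) t
          ≤⟨ x≤y+x _ (len-nonNegative y W) ⟩
        len y W + committed (run σ S) t ∎
        where
        ½v≤waiting : ½ * v ≤ waiting (run σ S) t
        ½v≤waiting =
          let q , q∈ , q≤β = find late
          in ≤-trans (x+z≤y⇒x≤y-z (≤-trans (+-monoʳ-≤ (½ * v) q≤β) (≤-reflexive ½v+β≈t)))
                     (delay≤maxDelay t q∈)
      bound (no prompt) = begin
        ½ * v + committed σ T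
          ≤⟨ +-monoˡ-≤ _ (threshold-halfway lawful s R trigger v+α≈t (threshold-nonNegative s R th) thβ) ⟩
        proj₁ (threshold-exists s R α≤β) + committed σ T
          ≤⟨ +-monoˡ-≤ _ (threshold≤len s R y (W ++ route S) covered thβ) ⟩
        len y (W ++ route S) + committed σ T
          ≈⟨ +-congʳ (len-++ y W (route S)) ⟩
        len y W + len (endpoint y W) (route S) + committed σ T
          ≡⟨ cong (λ x → len y W + len x (route S) + committed σ T) pos≡ ⟨
        len y W + l + committed σ T
          ≈⟨ solve 3 (λ w l c → w :+ l :+ c := w :+ (c :+ l)) ≈-refl (len y W) l (committed σ T) ⟩
        len y W + (committed σ T + l)
          ≤⟨ +-monoʳ-≤ (len y W) (committed-mono σ S T≤S (≤-trans T≤α α≤t)) ⟩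
        len y W + committed (run σ S) t ∎
        where
        thβ : threshold (terminals s R) α β (proj₁ (threshold-exists s R α≤β))
        thβ = proj₂ (threshold-exists s R α≤β)

        visited : ∀ {q} → q ∈ pending σ ⊎ q ∈ upcoming σ → arrival q ≤ β → location q ∈ y ∷ W ++ route S
        visited q∈ q≤β with run-visits t σ S S≤t q∈ (≤-trans q≤β β≤t)
        ... | inj₁ outstanding = contradiction (lose outstanding q≤β) prompt
        ... | inj₂ (here eq)  = ∈-++⁺ˡ (subst (_∈ y ∷ W) (≡.trans (≡.sym pos≡) (≡.sym eq)) (endpoint-∈ y W))
        ... | inj₂ (there x∈) = ∈-++⁺ʳ (y ∷ W) x∈

        anchorVisited : s ∈ y ∷ W ⊎ Outstanding s σ T → s ∈ y ∷ W ++ route S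
        anchorVisited (inj₁ s∈) = ∈-++⁺ˡ s∈
        -- The request at the anchor arrived by `T`, hence by `β`, so it is no longer pending at `t`
        -- and its location has been visited.
        anchorVisited (inj₂ (q , q∈ , refl , q≤T)) with ∈-receive⁻ T σ q∈
        ... | inj₁ q∈σ          = visited (inj₁ q∈σ) (≤-trans q≤T (≤-trans T≤α α≤β))
        ... | inj₂ (q∈up , _)   = visited (inj₂ q∈up) (≤-trans q≤T (≤-trans T≤α α≤β))

        covered : terminals s R β ⊆ y ∷ W ++ route S
        covered (here refl) = anchorVisited s∈
        covered (there x∈) with ∈-map⁻ location x∈
        ... | q , q∈P , refl with ∈-phaseRequests⁻ s R β q∈P
        ...   | q∈R , _ , q≤β = visited (inj₂ (R⊆ q∈R)) q≤β

  -- The competitive ratio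

  stateOf : Point → List Request → List Request → Carrier → State
  stateOf s B R z = record { position = s ; pending = B ; upcoming = R ; spent = z }

  parked : Point → List Request → Carrier → State
  parked s R z = stateOf s [] R z

  maxDelay≤ : ∀ t B {v} → 0# ≤ v → (∀ {q} → q ∈ B → t - arrival q ≤ v) → maxDelay t B ≤ v
  maxDelay≤ t B {v} 0≤v delays≤v with maxDelay-sel t B
  ... | inj₁ eq           = subst (_≤ v) (≡.sym eq) 0≤v
  ... | inj₂ (q , q∈ , eq) = subst (_≤ v) (≡.sym eq) (delays≤v q∈)

  module _ {rule : PhaseRule} {κ : Carrier} (lawful : Lawful rule κ) where
    open PhaseRule rule
    open Lawful lawful

    -- The walk visits every terminal, so nothing stays pending and the server is parked again,
    -- ready for the next phase. No request of the phase arrived before `α`, so the delay is at most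
    -- the threshold.
    perform-phase : ∀ {s R α t v F p} z → IsPhaseStart s R α → α ≤ t → v + α ≈ t →
                    threshold (terminals s R) α t v → root F ≡ s → (i : location p ∈ᵀ F) →
                    choice (phaseRequests s R t) (terminals s R t) F p i →
                    ∃ λ z′ → act (parked s R z) (t ▹ (openDFS F i ∷ [])) ≡ parked (location p) (later t R) z′ ×
                    z′ ≤ z + κ * v
    perform-phase {s} {R} {α} {t} {v} {F} {p} z (_ , earliest) α≤t v+α≈t th refl i ok =
      _ , cong₂ (λ x B → stateOf x B (later t R) (z + (len s W + maxDelay t served)))
        (openDFS-endpoint F i) allServed , (begin
        z + (len s W + maxDelay t served)     ≤⟨ +-monoʳ-≤ z (+-mono-≤ (openDFS-len F i) delay≤v) ⟩
        z + (weight F + weight F + v)         ≤⟨ +-monoʳ-≤ z (phaseCost s R α≤t th ok) ⟩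
        z + κ * v                             ∎)
      where
      W = openDFS F i
      waitingRequests = filter (λ q → ¬? (location q ≟ s)) (filter (λ q → arrival q ≤? t) R)
      served = filter (λ q → location q ∈? s ∷ W) waitingRequests

      waiting⁻ : ∀ {q} → q ∈ waitingRequests → q ∈ R × location q ≢ s × arrival q ≤ t
      waiting⁻ q∈ =
        let q∈arrived , q≢s = ∈-filter⁻ (λ q → ¬? (location q ≟ s)) {xs = filter (λ q → arrival q ≤? t) R} q∈
            q∈R , q≤t = ∈-filter⁻ (λ q → arrival q ≤? t) {xs = R} q∈arrived
        in q∈R , q≢s , q≤t

      allServed : filter (λ q → ¬? (location q ∈? s ∷ W)) waitingRequests ≡ []
      allServed = filter-none (λ q → ¬? (location q ∈? s ∷ W)) (All.tabulate λ q∈ missed →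
        let q∈R , q≢s , q≤t = waiting⁻ q∈
        in missed (openDFS-visits F i (choice-covers ok
             (there (∈-map⁺ location (∈-phaseRequests⁺ q∈R q≢s q≤t))))))

      delay≤v : maxDelay t served ≤ v
      delay≤v = maxDelay≤ t served (threshold-nonNegative s R th) λ {q} q∈ →
        let q∈R , q≢s , _ = waiting⁻ (proj₁ (∈-filter⁻ (λ q → location q ∈? s ∷ W) {xs = waitingRequests} q∈))
            α≤q = earliest (arrival q) (q , ∈-filter⁺ (λ q → ¬? (location q ≟ s)) q∈R q≢s , ≈-refl)
        in x≤y+z⇒x-z≤y (≤-trans (≤-reflexive (≈-sym v+α≈t)) (+-monoʳ-≤ v α≤q))

    ∈-later⁻ : ∀ {t R q} → q ∈ later t R → q ∈ R × ¬ arrival q ≤ t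
    ∈-later⁻ {t} {R} = ∈-filter⁻ (λ q → ¬? (arrival q ≤? t)) {xs = R}

    later≥ : ∀ {t R q} → q ∈ later t R → t ≤ arrival q
    later≥ {t} {R} {q} q∈ with total t (arrival q)
    ... | inj₁ t≤q = t≤q
    ... | inj₂ q≤t = contradiction q≤t (proj₂ (∈-later⁻ {t} {R} q∈))

    phaseStart≥ : ∀ {s R α τ} → IsPhaseStart s R α → (∀ {q} → q ∈ R → τ ≤ arrival q) → τ ≤ α
    phaseStart≥ {s} {R} ((q , q∈ , q≈α) , _) τ≤R =
      ≤-trans (τ≤R (proj₁ (∈-filter⁻ (λ q → ¬? (location q ≟ s)) {xs = R} q∈))) (≤-reflexive q≈α)

    -- Feasibility of runs.

    run-times : ∀ {s R S τ} → PhaseRun rule s R S → (∀ {q} → q ∈ R → τ ≤ arrival q) →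
                All (λ α → τ ≤ time α) S × AllPairs (λ α β → time α ≤ time β) S
    run-times (idle _) _ = [] , []
    run-times {R = R} (phase {t = t} start ((α≤t , _) , _) _ _ _ _ rest) τ≤R =
      let τ≤t = ≤-trans (phaseStart≥ {R = R} start τ≤R) α≤t
          t≤S , sorted = run-times rest (later≥ {t} {R})
      in τ≤t ∷ All.map (≤-trans τ≤t) t≤S , t≤S ∷ sorted

    run-served : ∀ {s R S} → PhaseRun rule s R S → ∀ z →
                 pending (run (parked s R z) S) ≡ [] ×
                 All (λ q → location q ≡ position (run (parked s R z) S)) (upcoming (run (parked s R z) S))
    run-served {s} {R} (idle noneAway) z = refl , All.tabulate λ {q} q∈R →
      decidable-stable (location q ≟ s) λ q≢s →
        contradiction (subst (q ∈_) noneAway (∈-filter⁺ (λ q → ¬? (location q ≟ s)) q∈R q≢s)) λ ()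
    run-served {s} {R} (phase {S = S} start trigger _ root≡ i ok rest) z =
      let α≤t , v , th , v+α≈t = trigger-threshold lawful s R trigger
          z′ , act≡ , _ = perform-phase {R = R} z start α≤t v+α≈t th root≡ i ok
      in subst (λ τ → pending (run τ S) ≡ [] × All (λ q → location q ≡ position (run τ S)) (upcoming (run τ S)))
           (≡.sym act≡) (run-served rest z′)

    run-feasible : ∀ {s I S} → PhaseRun rule s I S → Feasible s I S
    run-feasible {s} {I} run =
      let 0≤times , sorted = run-times run (λ {q} _ → Request.nonNegative q)
          noPending , upcomingHere = run-served run 0#
      in record
        { nonNegativeTimes   = 0≤times
        ; nondecreasingTimes = AllPairs⇒Linked sorted
        ; pendingServed      = noPending
        ; upcomingServed     = upcomingHere
        }

    -- The cost `κ * v` is `κ + κ` times half a threshold. Of the two copies of `w`, one grows by at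
    -- least `½ * v` less `m`, the other by the offline length `l`, which takes the place of `m` in
    -- the next phase.
    charge : ∀ {z z′ a v m l w w′ f} → 0# ≤ κ → z′ ≤ z + κ * v →
             ½ * v + w ≤ m + w′ → w + l ≤ w′ →
             a + (κ + κ) * (w′ + w′) ≤ z′ + (κ + κ) * (l + (f + f)) →
             a + (κ + κ) * (w + w) ≤ z + (κ + κ) * (m + (f + f))
    charge {z} {z′} {a} {v} {m} {l} {w} {w′} {f} 0≤κ phaseCost≤ charged walked rest =
      ≤-from (+-mono-≤ (+-mono-≤ rest phaseCost≤′) (*-monoʳ-≤ 0≤κ+κ (+-mono-≤ charged walked)))
        (solve 10 (λ k z z′ a h m l w w′ f →
          a :+ (k :+ k) :* (w :+ w) :+ (z′ :+ (k :+ k) :* (l :+ (f :+ f)) :+ (z :+ k :* (h :+ h)) :+ (k :+ k) :* (m :+ w′ :+ w′))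
          := z :+ (k :+ k) :* (m :+ (f :+ f)) :+ (a :+ (k :+ k) :* (w′ :+ w′) :+ z′ :+ (k :+ k) :* (h :+ w :+ (w :+ l))))
          ≈-refl κ z z′ a (½ * v) m l w w′ f)
      where
      0≤κ+κ : 0# ≤ κ + κ
      0≤κ+κ = 0≤x+y 0≤κ 0≤κ
      phaseCost≤′ : z′ ≤ z + κ * (½ * v + ½ * v)
      phaseCost≤′ = ≤-trans phaseCost≤ (≤-reflexive (+-congˡ (*-congˡ (≈-sym (½x+½x≈x v)))))

    -- Half of each threshold is charged to the offline cost that is committed
    -- during the phase and to the length of the offline walk during the
    -- preceding one.  Summed over all phases, either amounts to at most the
    -- offline cost.
    competitive : ∀ {s R S} → 0# ≤ κ → PhaseRun rule s R S → ∀ z σ S* {T y W σ*} →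
                  (∀ {q} → q ∈ R → q ∈ upcoming σ) → (∀ {q} → q ∈ R → T ≤ arrival q) →
                  position σ ≡ endpoint y W → s ∈ y ∷ W ⊎ Outstanding s σ T →
                  All (λ α → T ≤ time α) S* → AllPairs (λ α β → time α ≤ time β) S* →
                  run σ S* ≡ σ* → pending σ* ≡ [] → All (λ q → location q ≡ position σ*) (upcoming σ*) →
                  spent (run (parked s R z) S) + (κ + κ) * (committed σ T + committed σ T) ≤
                  z + (κ + κ) * (len y W + (spent σ* + spent σ*))
    competitive 0≤κ (idle _) z σ S* {T} {y} {W} _ _ _ _ T≤S* _ refl noPending upcomingHere =
      +-monoʳ-≤ z (*-monoʳ-≤ (0≤x+y 0≤κ 0≤κ) (≤-trans (+-mono-≤ committed≤ committed≤)
        (x≤y+x _ (len-nonNegative y W))))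
      where
      committed≤ : committed σ T ≤ spent (run σ S*)
      committed≤ = committed≤final σ S* T≤S* noPending upcomingHere
    competitive {s} {R} 0≤κ (phase {α} {t} {F} {p} {S} start trigger p∈P root≡ i ok rest) z σ S* {T} {y} {W} {σ*}
                R⊆ T≤R pos≡ s∈ T≤S* sorted final noPending upcomingHere =
      let α≤t , v , th , v+α≈t = trigger-threshold lawful s R trigger
          z′ , act≡ , z′≤ = perform-phase {R = R} z start α≤t v+α≈t th root≡ i ok
          S₁ , S₂ , S*≡ , S₁≤t , t≤S₂ , sorted₂ = splitAt t S* sorted
      in subst (λ τ → spent (run τ S) + (κ + κ) * (committed σ T + committed σ T) ≤
                      z + (κ + κ) * (len y W + (spent σ* + spent σ*)))
           (≡.sym act≡) (phases α≤t th v+α≈t z′≤ S₁ S₂ S*≡ S₁≤t t≤S₂ sorted₂)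
      where
      T≤α : T ≤ α
      T≤α = phaseStart≥ {R = R} start T≤R
      phases : ∀ {v z′} → α ≤ t → threshold (terminals s R) α t v → v + α ≈ t → z′ ≤ z + κ * v →
               ∀ S₁ S₂ → S* ≡ S₁ ++ S₂ → All (λ α → time α ≤ t) S₁ → All (λ α → t ≤ time α) S₂ →
               AllPairs (λ α β → time α ≤ time β) S₂ →
               spent (run (parked (location p) (later t R) z′) S) + (κ + κ) * (committed σ T + committed σ T) ≤
               z + (κ + κ) * (len y W + (spent σ* + spent σ*))
      phases {z′ = z′} α≤t th v+α≈t z′≤ S₁ S₂ S*≡ S₁≤t t≤S₂ sorted₂ =
        charge 0≤κ z′≤ (phase-bound lawful σ S₁ trigger α≤t v+α≈t th R⊆ T≤α pos≡ s∈ T≤S₁ S₁≤t)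
          (committed-mono σ S₁ T≤S₁ (≤-trans T≤α α≤t))
          (competitive 0≤κ rest z′ (run σ S₁) S₂
            (λ q∈ → let q∈R , q≰t = ∈-later⁻ {t} {R} q∈ in run-upcoming t σ S₁ S₁≤t (R⊆ q∈R) q≰t)
            (later≥ {t} {R}) (position-run σ S₁) p∈ t≤S₂ sorted₂
            (≡.trans (≡.sym (≡.trans (cong (run σ) S*≡) (foldl-++ act σ S₁ S₂))) final) noPending upcomingHere)
        where
        T≤S₁ : All (λ α → T ≤ time α) S₁
        T≤S₁ = All.++⁻ˡ S₁ (subst (All (λ α → T ≤ time α)) S*≡ T≤S*)
        -- The next anchor is a location requested in this phase, so by time `t` the offline server
        -- has visited it along `S₁` or still owes the service.
        p∈ : location p ∈ position σ ∷ route S₁ ⊎ Outstanding (location p) (run σ S₁) t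
        p∈ = let p∈R , _ , p≤t = ∈-phaseRequests⁻ s R t p∈P
             in Sum.swap (Sum.map₁ (λ p∈ → p , p∈ , refl , p≤t) (run-visits t σ S₁ S₁≤t (inj₂ (R⊆ p∈R)) p≤t))

    competitive-ratio : ∀ n {s I S opt} → 0# ≤ κ → (∀ x → (κ + κ) * (x + x) ≈ ℕ.suc n · x) →
                        IsOPT s I opt → PhaseRun rule s I S → cost s I S ≤ ℕ.suc n · opt
    competitive-ratio n {s} {I} {S} 0≤κ ratio isOPT phaseRun = infimum-scaled n isOPT bound
      where
      bound : ∀ z → (∃ λ S* → Feasible s I S* × cost s I S* ≈ z) → cost s I S ≤ ℕ.suc n · z
      bound z (S* , feasible , f≈z) = begin
        cost s I S
          ≤⟨ x≤x+y _ (*-nonNegative 0≤κ+κ (0≤x+y 0≤committed 0≤committed)) ⟩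
        cost s I S + (κ + κ) * (committed (initial s I) 0# + committed (initial s I) 0#)
          -- No phase precedes the first one: the earlier offline walk is empty and stands at the
          -- initial anchor.
          ≤⟨ competitive 0≤κ phaseRun 0# (initial s I) S* {y = s} {[]} id (λ {q} _ → Request.nonNegative q)
               refl (inj₁ (here refl)) nonNegativeTimes (Linked⇒AllPairs ≤-trans nondecreasingTimes)
               refl pendingServed upcomingServed ⟩
        0# + (κ + κ) * (0# + (f + f))
          ≈⟨ solve 2 (λ k f → con 0 :+ k :* (con 0 :+ (f :+ f)) := k :* (f :+ f)) ≈-refl (κ + κ) f ⟩
        (κ + κ) * (f + f)
          ≈⟨ *-congˡ (+-cong f≈z f≈z) ⟩
        (κ + κ) * (z + z)
          ≈⟨ ratio z ⟩
        ℕ.suc n · z ∎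
        where
        open Feasible feasible
        f = cost s I S*
        0≤κ+κ : 0# ≤ κ + κ
        0≤κ+κ = 0≤x+y 0≤κ 0≤κ
        0≤committed : 0# ≤ committed (initial s I) 0#
        0≤committed = 0≤x+y ≤-refl (maxDelay-nonNegative 0# (pending (receive 0# (initial s I))))

    online-algorithm : ∀ n {s I opt} → 0# ≤ κ → (∀ x → (κ + κ) * (x + x) ≈ ℕ.suc n · x) → IsOPT s I opt →
                    (∃ λ S → PhaseRun rule s I S) ×
                    (∀ S → PhaseRun rule s I S → Feasible s I S × cost s I S ≤ ℕ.suc n · opt)
    online-algorithm n {s} {I} 0≤κ ratio isOPT =
      run-exists lawful (length I) s I ℕ.≤-refl ,
      λ S phaseRun → run-feasible phaseRun , competitive-ratio n 0≤κ ratio isOPT phaseRun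

corollary6p7 : {c ℓ₁ ℓ₂ : Level} (K : OrderedField c ℓ₁ ℓ₂) (M : FiniteMetricSpace K) →
    let open OrderedField K
        open FiniteMetricSpace M
        open OnlineService K M
    in
    (s₀ : Point) (I : Input) (opt : Carrier) → IsOPT s₀ I opt →
    ((∃ λ S → PhaseRun exactSteiner s₀ I S) ×
     (∀ S → PhaseRun exactSteiner s₀ I S →
        Feasible s₀ I S × cost s₀ I S ≤ 12 · opt)) ×
    ((∃ λ S → PhaseRun terminalMST s₀ I S) ×
     (∀ S → PhaseRun terminalMST s₀ I S →
        Feasible s₀ I S × cost s₀ I S ≤ 20 · opt))
corollary6p7 K M s₀ I opt isOPT =
  -- The ratio is passed as a successor, here of 11, so that it is nonzero and can be inverted in
  -- the field.
  online-algorithm exactSteiner-lawful 11 0≤3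
    (solve 1 (λ x → (three :+ three) :* (x :+ x) := 12 :· x) ≈-refl) isOPT ,
  online-algorithm terminalMST-lawful 19 (0≤x+y (0≤x+y 0≤3 0≤1) 0≤1)
    (solve 1 (λ x → (five :+ five) :* (x :+ x) := 20 :· x) ≈-refl) isOPT
  where
  open OrderedField K
  open OrderedFieldProperties K
  open Solver using (solve; _:=_; _:+_; _:*_; con; Polynomial)
  open Competitive K M

  0≤3 : 0# ≤ 1# + 1# + 1#
  0≤3 = 0≤x+y (0≤x+y 0≤1 0≤1) 0≤1

  three five : ∀ {n} → Polynomial n
  three = con 1 :+ con 1 :+ con 1
  five  = three :+ con 1 :+ con 1

  _:·_ : ∀ {n} → ℕ → Polynomial n → Polynomial n
  ℕ.zero  :· x = con 0
  ℕ.suc n :· x = x :+ n :· x
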